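{- For every integer $N\ge1$ and every integer $n\ge0$, the following identity holds (as rational functions in $x$): $$\sum_{l=0}^{n}\binom{N+n-l}{n-l}V_{l}^{(N+1)}(x)=\frac{1}{2^{N}N!}\sum_{i=1}^{N}\sum_{l=0}^{i}a_{i}(N)\frac{i!}{l!}\sum_{m+s+p=n}\binom{2N+m-i-1}{m}\binom{i-l+s}{s}(p+l)_{l}\,x^{i-2N-m}\,V_{p+l}(x),$$ where the innermost sum is over all integers $m,s,p\ge0$ with $m+s+p=n$.
   Context: The Chebyshev polynomials of the third kind $V_n(x)$ and the higher-order ones $V_n^{(\alpha)}(x)$ are defined by the formal power series in $t$ $$\frac{1-t}{1-2xt+t^{2}}=\sum_{n=0}^{\infty}V_{n}(x)t^{n},\qquad \left(\frac{1-t}{1-2xt+t^{2}}\right)^{\alpha}=\sum_{n=0}^{\infty}V_{n}^{(\alpha)}(x)t^{n}.$$ For a number $y$ and integer $n\ge1$, $(y)_{n}=y(y-1)\cdots(y-n+1)$ is the falling factorial, and $(y)_{0}=1$. The double factorial is $(2k-1)!!=(2k-1)(2k-3)\cdots 3\cdot 1$ for $k\ge1$, with $(-1)!!=1$. The numbers $a_i(N)$, $1\le i\le N$, are defined by $a_{1}(N)=(2N-3)!!$ and, for $2\le i\le N$, $$a_{i}(N)=\sum_{k_{i-1}=0}^{N-i}\ \sum_{k_{i-2}=0}^{N-i-k_{i-1}}\cdots\sum_{k_{1}=0}^{N-i-k_{i-1}-\cdots-k_{2}}2^{\sum_{j=1}^{i-1}k_{j}}\left[\prod_{j=2}^{i}\left(N-\sum_{l=j}^{i-1}k_{l}-\frac{2i+2-j}{2}\right)_{k_{j-1}}\right]\left(2\left(N-i-\sum_{j=1}^{i-1}k_{j}\right)-1\right)!!,$$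 where empty sums are $0$. -}

module Defs where

open import Level using (Level)
open import Algebra.Bundles.Raw using (RawMonoid; RawRing)
import Algebra.Definitions.RawMonoid as RawMonoidDefs
import Algebra.Definitions.RawSemiring as RawSemiringDefs
open import Data.Empty using (⊥-elim)
open import Data.Fin.Base using (toℕ)
open import Data.Integer.Base as ℤ using (ℤ; +_; -[1+_])
open import Data.List.Base using (List; []; _∷_; map)
open import Data.List.Relation.Unary.Any using (Any; here; there)
open import Data.Nat.Base as ℕ using (ℕ; zero; suc; _∸_; _<_; s≤s; z≤n)
import Data.Nat.Properties as ℕₚ
open import Data.Product.Base using (Σ; _×_; _,_)
open import Data.Rational.Base as ℚ using (ℚ; 0ℚ; 1ℚ)
import Data.Rational.Properties as ℚₚ
open import Data.Vec.Base as Vec using (Vec; []; _∷_)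
open import Relation.Binary.PropositionalEquality
open import Relation.Nullary using (yes; no; does)
open import Data.Bool.Base using (if_then_else_)

-- f a ∙ f (a + 1) ∙ ⋯ ∙ f b, which is ε when b < a.
module _ {c ℓ : Level} (M : RawMonoid c ℓ) where
  open RawMonoid M using (Carrier)

  bigOp : (a b : ℕ) → (ℕ → Carrier) → Carrier
  bigOp a b f = RawMonoidDefs.sum M {suc b ∸ a} (λ k → f (a ℕ.+ toℕ k))

-- Polynomials in one indeterminate, as lists of coefficients with the constant
-- coefficient first; trailing zeros are allowed and are invisible to _≈ₚ_.
module Polynomials {c ℓ : Level} (R : RawRing c ℓ) where
  open RawRing R

  Poly : Set c
  Poly = List Carrier

  coeff : Poly → ℕ → Carrier
  coeff []      _       = 0#
  coeff (a ∷ _) zero    = a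
  coeff (_ ∷ p) (suc n) = coeff p n

  infix  4 _≈ₚ_
  infixl 6 _+ₚ_
  infixl 7 _*ₚ_

  _≈ₚ_ : Poly → Poly → Set ℓ
  p ≈ₚ q = ∀ n → coeff p n ≈ coeff q n

  _+ₚ_ : Poly → Poly → Poly
  []      +ₚ q       = q
  (a ∷ p) +ₚ []      = a ∷ p
  (a ∷ p) +ₚ (b ∷ q) = (a + b) ∷ (p +ₚ q)

  _*ₚ_ : Poly → Poly → Poly
  []      *ₚ q = []
  (a ∷ p) *ₚ q = map (a *_) q +ₚ (0# ∷ (p *ₚ q))

  rawRing : RawRing c ℓ
  rawRing = record
    { Carrier = Poly
    ; _≈_     = _≈ₚ_
    ; _+_     = _+ₚ_
    ; _*_     = _*ₚ_
    ; -_      = map (λ a → - a)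
    ; 0#      = []
    ; 1#      = 1# ∷ []
    }

module PowerSeries {c ℓ : Level} (R : RawRing c ℓ) where
  open RawRing R

  Series : Set c
  Series = ℕ → Carrier

  one : Series
  one zero    = 1#
  one (suc _) = 0#

  mul : Series → Series → Series
  mul f g n = bigOp +-rawMonoid 0 n (λ k → f k * g (n ∸ k))

  rawRing : RawRing c ℓ
  rawRing = record
    { Carrier = Series
    ; _≈_     = λ f g → ∀ n → f n ≈ g n
    ; _+_     = λ f g n → f n + g n
    ; _*_     = mul
    ; -_      = λ f n → - f n
    ; 0#      = λ _ → 0#
    ; 1#      = one
    }

  -- The quotient h = a / f for f with constant coefficient 1, i.e. the unique h
  -- with f h = a.  Comparing coefficients of t ^ n gives
  --   h n = a n - ∑_{k < n} f (k + 1) h (n - 1 - k).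
  -- quotientPrefix n lists h (n - 1), …, h 0.
  module _ (a f : Series) .(monic : f 0 ≡ 1#) where
    quotientPrefix : (n : ℕ) → Vec Carrier n
    quotientPrefix zero    = []
    quotientPrefix (suc n) =
      (a n + - RawMonoidDefs.sum +-rawMonoid
                 (λ k → f (suc (toℕ k)) * Vec.lookup (quotientPrefix n) k))
      ∷ quotientPrefix n

    quotient : Series
    quotient n = Vec.head (quotientPrefix (suc n))

module ℚ[x] = Polynomials ℚ.+-*-rawRing
open ℚ[x] public using (Poly; coeff; _≈ₚ_; _+ₚ_; _*ₚ_)

NonZeroPoly : Poly → Set
NonZeroPoly = Any (_≢ 0ℚ)

X : Poly
X = 0ℚ ∷ 1ℚ ∷ []

NonZeroPoly-1 : NonZeroPoly (1ℚ ∷ [])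
NonZeroPoly-1 = here λ ()

NonZeroPoly-X : NonZeroPoly X
NonZeroPoly-X = there (here λ ())

-- ℚ[x] has no zero divisors: the lowest nonzero coefficients multiply.
Low : Poly → ℕ → Set
Low p i = coeff p i ≢ 0ℚ × (∀ j → j < i → coeff p j ≡ 0ℚ)

low : ∀ {p} → NonZeroPoly p → Σ ℕ (Low p)
low (here a≢0) = 0 , a≢0 , λ _ ()
low {a ∷ p} (there nz) with a ℚₚ.≟ 0ℚ | low nz
... | no a≢0  | _               = 0 , a≢0 , λ _ ()
... | yes a≡0 | i , pᵢ≢0 , p<i≡0 = suc i , pᵢ≢0 , below
  where
  below : ∀ j → j < suc i → coeff (a ∷ p) j ≡ 0ℚ
  below zero    _         = a≡0
  below (suc j) (s≤s j<i) = p<i≡0 j j<i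

coeff≢0⇒NonZeroPoly : ∀ p n → coeff p n ≢ 0ℚ → NonZeroPoly p
coeff≢0⇒NonZeroPoly []      n       c≢0 = ⊥-elim (c≢0 refl)
coeff≢0⇒NonZeroPoly (a ∷ p) zero    c≢0 = here c≢0
coeff≢0⇒NonZeroPoly (a ∷ p) (suc n) c≢0 = there (coeff≢0⇒NonZeroPoly p n c≢0)

coeff-+ : ∀ p q n → coeff (p +ₚ q) n ≡ coeff p n ℚ.+ coeff q n
coeff-+ []      q       n       = sym (ℚₚ.+-identityˡ _)
coeff-+ (a ∷ p) []      n       = sym (ℚₚ.+-identityʳ _)
coeff-+ (a ∷ p) (b ∷ q) zero    = refl
coeff-+ (a ∷ p) (b ∷ q) (suc n) = coeff-+ p q n

coeff-map : ∀ a q n → coeff (map (a ℚ.*_) q) n ≡ a ℚ.* coeff q n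
coeff-map a []      n       = sym (ℚₚ.*-zeroʳ a)
coeff-map a (b ∷ q) zero    = refl
coeff-map a (b ∷ q) (suc n) = coeff-map a q n

coeff-* : ∀ a p q n →
  coeff ((a ∷ p) *ₚ q) n ≡ a ℚ.* coeff q n ℚ.+ coeff (0ℚ ∷ (p *ₚ q)) n
coeff-* a p q n = trans (coeff-+ (map (a ℚ.*_) q) _ n)
                        (cong (ℚ._+ _) (coeff-map a q n))

coeff-*-below : ∀ p q j → (∀ k → k < j → coeff q k ≡ 0ℚ) →
                ∀ k → k < j → coeff (p *ₚ q) k ≡ 0ℚ
coeff-*-below []      q j q<j≡0 k k<j = refl
coeff-*-below (a ∷ p) q j q<j≡0 k k<j = begin
  coeff ((a ∷ p) *ₚ q) k                         ≡⟨ coeff-* a p q k ⟩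
  a ℚ.* coeff q k ℚ.+ coeff (0ℚ ∷ (p *ₚ q)) k    ≡⟨ cong₂ (λ u v → a ℚ.* u ℚ.+ v) (q<j≡0 k k<j) (shifted k k<j) ⟩
  a ℚ.* 0ℚ ℚ.+ 0ℚ                                ≡⟨ cong (ℚ._+ 0ℚ) (ℚₚ.*-zeroʳ a) ⟩
  0ℚ                                             ∎
  where
  open ≡-Reasoning
  shifted : ∀ k → k < j → coeff (0ℚ ∷ (p *ₚ q)) k ≡ 0ℚ
  shifted zero    _   = refl
  shifted (suc k) k<j = coeff-*-below p q j q<j≡0 k (ℕₚ.<⇒≤ k<j)

coeff-*-low : ∀ p q i j → (∀ k → k < i → coeff p k ≡ 0ℚ) →
              (∀ k → k < j → coeff q k ≡ 0ℚ) →
              coeff (p *ₚ q) (i ℕ.+ j) ≡ coeff p i ℚ.* coeff q j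
coeff-*-low []      q i    j _ _ = sym (ℚₚ.*-zeroˡ (coeff q j))
coeff-*-low (a ∷ p) q zero j _ q<j≡0 = begin
  coeff ((a ∷ p) *ₚ q) j                         ≡⟨ coeff-* a p q j ⟩
  a ℚ.* coeff q j ℚ.+ coeff (0ℚ ∷ (p *ₚ q)) j    ≡⟨ cong (a ℚ.* coeff q j ℚ.+_) (shifted j q<j≡0) ⟩
  a ℚ.* coeff q j ℚ.+ 0ℚ                         ≡⟨ ℚₚ.+-identityʳ _ ⟩
  a ℚ.* coeff q j                                ∎
  where
  open ≡-Reasoning
  shifted : ∀ j → (∀ k → k < j → coeff q k ≡ 0ℚ) → coeff (0ℚ ∷ (p *ₚ q)) j ≡ 0ℚ
  shifted zero    _     = refl
  shifted (suc j) q<j≡0 = coeff-*-below p q (suc j) q<j≡0 j (ℕₚ.n<1+n j)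
coeff-*-low (a ∷ p) q (suc i) j p<i≡0 q<j≡0 = begin
  coeff ((a ∷ p) *ₚ q) (suc i ℕ.+ j)             ≡⟨ coeff-* a p q (suc i ℕ.+ j) ⟩
  a ℚ.* c ℚ.+ coeff (p *ₚ q) (i ℕ.+ j)           ≡⟨ cong₂ (λ u v → u ℚ.* c ℚ.+ v)
                                                      (p<i≡0 0 (s≤s z≤n))
                                                      (coeff-*-low p q i j (λ k k<i → p<i≡0 (suc k) (s≤s k<i)) q<j≡0) ⟩
  0ℚ ℚ.* c ℚ.+ coeff p i ℚ.* coeff q j           ≡⟨ cong (ℚ._+ coeff p i ℚ.* coeff q j) (ℚₚ.*-zeroˡ c) ⟩
  0ℚ ℚ.+ coeff p i ℚ.* coeff q j                 ≡⟨ ℚₚ.+-identityˡ _ ⟩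
  coeff p i ℚ.* coeff q j                        ∎
  where
  open ≡-Reasoning
  c = coeff q (suc i ℕ.+ j)

*-nonZero : ∀ {a b} → a ≢ 0ℚ → b ≢ 0ℚ → a ℚ.* b ≢ 0ℚ
*-nonZero {a} {b} a≢0 b≢0 ab≡0 = b≢0 (begin
  b                    ≡⟨ ℚₚ.*-identityˡ b ⟨
  1ℚ ℚ.* b             ≡⟨ cong (ℚ._* b) (ℚₚ.*-inverseˡ a) ⟨
  (ℚ.1/ a) ℚ.* a ℚ.* b ≡⟨ ℚₚ.*-assoc (ℚ.1/ a) a b ⟩
  ℚ.1/ a ℚ.* (a ℚ.* b) ≡⟨ cong (ℚ.1/ a ℚ.*_) ab≡0 ⟩
  ℚ.1/ a ℚ.* 0ℚ        ≡⟨ ℚₚ.*-zeroʳ (ℚ.1/ a) ⟩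
  0ℚ                   ∎)
  where
  open ≡-Reasoning
  instance _ = ℚ.≢-nonZero a≢0

NonZeroPoly-* : ∀ {p q} → NonZeroPoly p → NonZeroPoly q → NonZeroPoly (p *ₚ q)
NonZeroPoly-* {p} {q} p≢0 q≢0 with low p≢0 | low q≢0
... | i , pᵢ≢0 , p<i≡0 | j , qⱼ≢0 , q<j≡0 =
  coeff≢0⇒NonZeroPoly (p *ₚ q) (i ℕ.+ j)
    (λ c≡0 → *-nonZero pᵢ≢0 qⱼ≢0 (trans (sym (coeff-*-low p q i j p<i≡0 q<j≡0)) c≡0))

-- ℚ(x), the field of fractions of ℚ[x]

record RatFun : Set where
  constructor mkRatFun
  field
    num   : Poly
    den   : Poly
    den≢0 : NonZeroPoly den

open RatFun public

infix  4 _≃_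
infixl 6 _⊕_
infixl 7 _⊗_

_≃_ : RatFun → RatFun → Set
f ≃ g = (num f *ₚ den g) ≈ₚ (num g *ₚ den f)

_⊕_ : RatFun → RatFun → RatFun
f ⊕ g = mkRatFun (num f *ₚ den g +ₚ num g *ₚ den f) (den f *ₚ den g)
                 (NonZeroPoly-* (den≢0 f) (den≢0 g))

_⊗_ : RatFun → RatFun → RatFun
f ⊗ g = mkRatFun (num f *ₚ num g) (den f *ₚ den g)
                 (NonZeroPoly-* (den≢0 f) (den≢0 g))

fromPoly : Poly → RatFun
fromPoly p = mkRatFun p (1ℚ ∷ []) NonZeroPoly-1

fromℚ : ℚ → RatFun
fromℚ a = fromPoly (a ∷ [])

fromℕ : ℕ → RatFun
fromℕ n = fromℚ (+ n ℚ./ 1)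

ℚ⟨x⟩-rawRing : RawRing _ _
ℚ⟨x⟩-rawRing = record
  { Carrier = RatFun
  ; _≈_     = _≃_
  ; _+_     = _⊕_
  ; _*_     = _⊗_
  ; -_      = λ f → mkRatFun (map (λ a → ℚ.- a) (num f)) (den f) (den≢0 f)
  ; 0#      = fromℕ 0
  ; 1#      = fromℕ 1
  }

X^_ : ℤ → RatFun
X^ (+ n)    = fromPoly X ^ n
  where open RawSemiringDefs (RawRing.rawSemiring ℚ⟨x⟩-rawRing) using (_^_)
X^ -[1+ n ] = mkRatFun (1ℚ ∷ []) X NonZeroPoly-X ^ suc n
  where open RawSemiringDefs (RawRing.rawSemiring ℚ⟨x⟩-rawRing) using (_^_)

∑ : (a b : ℕ) → (ℕ → RatFun) → RatFun
∑ = bigOp (RawRing.+-rawMonoid ℚ⟨x⟩-rawRing)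

∑ℚ : (a b : ℕ) → (ℕ → ℚ) → ℚ
∑ℚ = bigOp (RawRing.+-rawMonoid ℚ.+-*-rawRing)

∏ℚ : (a b : ℕ) → (ℕ → ℚ) → ℚ
∏ℚ = bigOp (RawRing.*-rawMonoid ℚ.+-*-rawRing)

∑ℕ : (a b : ℕ) → (ℕ → ℕ) → ℕ
∑ℕ = bigOp ℕ.+-0-rawMonoid

-- Chebyshev polynomials of the third kind, from the generating function in
-- ℚ[x][[t]].  Polynomials in t over ℚ[x] are turned into series by coeff.

module ℚ[x][t]   = Polynomials ℚ[x].rawRing
module ℚ[x][[t]] = PowerSeries ℚ[x].rawRing

V-series : ℚ[x][[t]].Series
V-series = ℚ[x][[t]].quotient
  (ℚ[x][t].coeff (1# ∷ - 1# ∷ []))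
  (ℚ[x][t].coeff (1# ∷ - (X + X) ∷ 1# ∷ []))
  refl
  where open RawRing ℚ[x].rawRing using (_+_; -_; 1#)

V : ℕ → Poly
V = V-series

V⟨_⟩ : (α : ℕ) → ℕ → Poly
V⟨ α ⟩ = V-series ^ α
  where open RawSemiringDefs (RawRing.rawSemiring ℚ[x][[t]].rawRing) using (_^_)

fallingFactorial : ℚ → ℕ → ℚ
fallingFactorial y zero    = 1ℚ
fallingFactorial y (suc n) = fallingFactorial y n ℚ.* (y ℚ.- (+ n ℚ./ 1))

[2_-1]!! : ℕ → ℕ
[2 zero  -1]!! = 1
[2 suc k -1]!! = (2 ℕ.* k ℕ.+ 1) ℕ.* [2 k -1]!!

infixl 9 _[_↦_]
_[_↦_] : (ℕ → ℕ) → ℕ → ℕ → (ℕ → ℕ)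
(k [ d ↦ v ]) j = if does (j ℕₚ.≟ d) then v else k j

-- ∑_{k_d = 0}^{r} ∑_{k_{d-1} = 0}^{r - k_d} ⋯ ∑_{k_1 = 0}^{r - k_d - ⋯ - k_2} F k,
-- where k : ℕ → ℕ has k j = k_j for 1 ≤ j ≤ d, and k j = 0 for other j.
nested-∑ : (d r : ℕ) → ((ℕ → ℕ) → ℚ) → ℚ
nested-∑ zero    r F = F (λ _ → 0)
nested-∑ (suc d) r F =
  ∑ℚ 0 r (λ v → nested-∑ d (r ∸ v) (λ k → F (k [ suc d ↦ v ])))

a-summand : (i N : ℕ) → (ℕ → ℕ) → ℚ
a-summand i N k =
  (+ (2 ℕ.^ ∑ℕ 1 (i ∸ 1) k) ℚ./ 1)
  ℚ.* ∏ℚ 2 i (λ j → fallingFactorial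
                      ((+ N ℚ./ 1) ℚ.- (+ ∑ℕ j (i ∸ 1) k ℚ./ 1)
                                   ℚ.- (+ (2 ℕ.* i ℕ.+ 2 ∸ j) ℚ./ 2))
                      (k (j ∸ 1)))
  ℚ.* (+ [2 (N ∸ i ∸ ∑ℕ 1 (i ∸ 1) k) -1]!! ℚ./ 1)

-- Only 1 ≤ i ≤ N is meaningful; there every truncated subtraction here and in
-- a-summand is exact.  Note 2N - 3 = 2(N - 1) - 1.
a : (i N : ℕ) → ℚ
a 0                 N = 0ℚ
a 1                 N = + [2 (N ∸ 1) -1]!! ℚ./ 1
a i@(suc (suc _))   N = nested-∑ (i ∸ 1) (N ∸ i) (a-summand i N)

1/2^_*_! : ℕ → ℕ → ℚ
1/2^ N * M ! = + 1 ℚ./ (2 ℕ.^ N ℕ.* M ℕ.!)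
  where instance _ = ℕₚ.m*n≢0 (2 ℕ.^ N) (M ℕ.!) {{ℕₚ.m^n≢0 2 N}} {{M ℕₚ.!≢0}}

_!/_! : ℕ → ℕ → ℚ
i !/ l ! = + (i ℕ.!) ℚ./ (l ℕ.!)
  where instance _ = l ℕₚ.!≢0

{-# OPTIONS --safe #-}

-- Let G = 1 / (1 - 2xt + t²), so that G′ = 2 (x - t) G².  Differentiating
--   2ᴺ N! Gᴺ⁺¹ = ∑ᵢ aᵢ(N) (x - t)ⁱ⁻²ᴺ G⁽ⁱ⁾
-- and dividing by x - t shows that it holds for all N ≥ 1 with coefficients satisfying
--   aᵢ(N + 1) = (2N - i) aᵢ(N) + aᵢ₋₁(N),
-- and splitting off the outermost summation index shows that the nested sums obey this
-- recurrence.  With F = (1 - t) G the generating function of the Vₙ, the left-hand side is the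
-- coefficient of tⁿ in (1 - t)⁻ᴺ⁻¹ Fᴺ⁺¹ = Gᴺ⁺¹, and the Leibniz rule for G = (1 - t)⁻¹ F
-- followed by the binomial series turns the right-hand side into the stated triple sum.
-- Putting t = xu and multiplying by x²ᴺ⁺ⁿ keeps everything in ℚ[x][[u]].

module Submission where

open import Defs
open import Algebra.Bundles using (CommutativeRing; Monoid)
open import Algebra.Bundles.Raw using (RawRing)
import Algebra.Construct.Pointwise as Pointwise
import Algebra.Definitions.RawMonoid as RawMonoidDefs
import Algebra.Definitions.RawSemiring as RawSemiringDefs
import Algebra.Morphism.RingMonomorphism as RingMonomorphism
open import Algebra.Morphism.Structures using (IsRingMonomorphism)
import Algebra.Properties.CommutativeSemiring.Exp as CommutativeExp
import Algebra.Properties.Group as GroupProperties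
import Algebra.Properties.Monoid.Sum as MonoidSum
import Algebra.Properties.Ring as RingProperties
import Algebra.Properties.Semiring.Exp as Exp
import Algebra.Properties.Semiring.Mult as Mult
import Algebra.Properties.Semiring.Sum as Sum
open import Algebra.Structures using (IsCommutativeRing)
open import Data.Bool.Base using (if_then_else_)
open import Data.Fin.Base as Fin using (Fin; toℕ)
open import Data.Fin.Properties using (toℕ<n)
open import Data.Integer.Base as ℤ using (+_; -[1+_])
import Data.Integer.Properties as ℤₚ
open import Data.Integer.Tactic.RingSolver using () renaming (solve-∀ to ℤ-solve-∀)
open import Data.List.Base using ([]; _∷_; map)
open import Data.Nat.Base as ℕ using (ℕ; zero; suc; _≤_; _<_; _∸_; _!; z≤n; s≤s)
open import Data.Nat.Combinatorics using (_C_; nCn≡1; nC1≡n; nCk≡nC[n∸k]; nCk+nC[k+1]≡[n+1]C[k+1])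
import Data.Nat.Properties as ℕₚ
open import Data.Nat.Tactic.RingSolver using () renaming (solve-∀ to ℕ-solve-∀)
open import Data.Product.Base using (_,_)
open import Data.Rational.Base as ℚ using (ℚ; 0ℚ; 1ℚ; _/_; toℚᵘ)
import Data.Rational.Properties as ℚₚ
open import Data.Rational.Solver using (module +-*-Solver)
open import Data.Rational.Unnormalised.Base as ℚᵘ using (mkℚᵘ; *≡*)
import Data.Rational.Unnormalised.Properties as ℚᵘₚ
import Data.Vec.Base as Vec
open import Function.Base using (_∘_; id)
open import Level using (_⊔_)
open import Relation.Binary.PropositionalEquality as ≡ using (_≡_; _≢_)
open import Relation.Nullary.Decidable using (dec-true; dec-false)

-- With t = xu one has d/du = x d/dt, so the i-th derivative of G contributes x^(-i), which cancels
-- against (x - t)^(i-2N) = x^(i-2N) (1 - u)^(i-2N). The same factor x^(-2N) remains for every i and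
-- is cleared once; the differential equation becomes B DH = 2x^2 H^2 with B = 1/(1 - u), and the
-- induction runs over any commutative ring, with aᵢ(N) entering as natural numbers. The nested sums
-- satisfy the recurrence because (y+1)_(v+1) = (y+1) (y)_v: raising N by one while shifting the
-- outermost index from v to v+1 multiplies a term by the constant 2N - i, and the new term v = 0 is
-- aᵢ₋₁(N). Addition in ℚ(x) multiplies denominators, so the two sides of the theorem carry large
-- unrelated denominators. These are never computed: each side is shown to equal p / x^(2N+n) with
-- the same polynomial p, by cross-multiplication, and powers of x cancel because multiplying by x
-- only shifts coefficients.

module _ {c ℓ} (M : Monoid c ℓ) where
  open Monoid M
  open MonoidSum M using (sum)

  sum-last : ∀ n f → sum {suc n} (λ k → f (toℕ k)) ≈ sum {n} (λ k → f (toℕ k)) ∙ f n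
  sum-last zero    f = trans (identityʳ _) (sym (identityˡ _))
  sum-last (suc n) f = trans (∙-congˡ (sum-last n (λ k → f (suc k)))) (sym (assoc _ _ _))

-- Finite sums and images of natural numbers in a commutative ring

module Ranges {c ℓ} (R : CommutativeRing c ℓ) where
  open CommutativeRing R
  open import Algebra.Solver.Ring.NaturalCoefficients.Default commutativeSemiring public
    using (solve; _:=_; _:+_; _:*_; con)
  open Sum semiring using (sum; sum-cong-≋; ∑-distrib-+; *-distribˡ-sum)
  open Mult semiring using (_×_; ×1-homo-*; ×-homo-+)

  sumTo : ℕ → (ℕ → Carrier) → Carrier
  sumTo n f = sum {n} (λ k → f (toℕ k))

  sumTo-cong : ∀ n {f g} → (∀ k → k < n → f k ≈ g k) → sumTo n f ≈ sumTo n g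
  sumTo-cong n f≈g = sum-cong-≋ (λ k → f≈g (toℕ k) (toℕ<n k))

  sumTo-+ : ∀ n f g → sumTo n (λ k → f k + g k) ≈ sumTo n f + sumTo n g
  sumTo-+ n f g = ∑-distrib-+ {n} (f ∘ toℕ) (g ∘ toℕ)

  sumTo-* : ∀ n x f → x * sumTo n f ≈ sumTo n (λ k → x * f k)
  sumTo-* n x f = *-distribˡ-sum {n} x (f ∘ toℕ)

  sumTo-last : ∀ n f → sumTo (suc n) f ≈ sumTo n f + f n
  sumTo-last = sum-last +-monoid

  ⟦_⟧ : ℕ → Carrier
  ⟦ n ⟧ = n × 1#

  ⟦⟧-cong : ∀ {m n} → m ≡ n → ⟦ m ⟧ ≈ ⟦ n ⟧
  ⟦⟧-cong ≡.refl = refl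

  ⟦⟧-+ : ∀ m n → ⟦ m ℕ.+ n ⟧ ≈ ⟦ m ⟧ + ⟦ n ⟧
  ⟦⟧-+ = ×-homo-+ 1#

  ⟦⟧-* : ∀ m n → ⟦ m ℕ.* n ⟧ ≈ ⟦ m ⟧ * ⟦ n ⟧
  ⟦⟧-* = ×1-homo-*

  ⟦1⟧ : ⟦ 1 ⟧ ≈ 1#
  ⟦1⟧ = +-identityʳ 1#

-- Differential algebra

record IsDerivation {c ℓ} (S : CommutativeRing c ℓ)
                    (D : CommutativeRing.Carrier S → CommutativeRing.Carrier S) :
                    Set (c ⊔ ℓ) where
  open CommutativeRing S
  field
    D-cong : ∀ {f g} → f ≈ g → D f ≈ D g
    D-+    : ∀ f g → D (f + g) ≈ D f + D g
    D-*    : ∀ f g → D (f * g) ≈ D f * g + f * D g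

-- aℕ n j is a_{j+1}(n+1), extended by 0 to j > n.  The recurrence is what differentiation
-- does to the expansion of H ^ (n + 2) in power-expansion.
aℕ : ℕ → ℕ → ℕ
aℕ zero    zero    = 1
aℕ zero    (suc j) = 0
aℕ (suc n) zero    = (2 ℕ.* n ℕ.+ 1) ℕ.* aℕ n zero
aℕ (suc n) (suc j) = (2 ℕ.* n ∸ j) ℕ.* aℕ n (suc j) ℕ.+ aℕ n j

aℕ-zero : ∀ {n j} → n < j → aℕ n j ≡ 0
aℕ-zero {zero}  {suc j} _ = ≡.refl
aℕ-zero {suc n} {suc j} (s≤s n<j) = ≡.cong₂ ℕ._+_
  (≡.trans (≡.cong ((2 ℕ.* n ∸ j) ℕ.*_) (aℕ-zero (ℕₚ.m≤n⇒m≤1+n n<j))) (ℕₚ.*-zeroʳ (2 ℕ.* n ∸ j)))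
  (aℕ-zero n<j)

-- The integer (l + d)! / l!, built without division so that it has an image in every commutative
-- ring.
quotient-! : ℕ → ℕ → ℕ
quotient-! l zero    = 1
quotient-! l (suc d) = (l ℕ.+ suc d) ℕ.* quotient-! l d

module Differential {c ℓ} (S : CommutativeRing c ℓ)
  (D : CommutativeRing.Carrier S → CommutativeRing.Carrier S) (isDerivation : IsDerivation S D)
  where
  open CommutativeRing S
  open IsDerivation isDerivation
  open Ranges S
  open Exp semiring using (_^_; ^-cong)
  open GroupProperties +-group using (identityˡ-unique; ∙-cancelʳ)
  open import Relation.Binary.Reasoning.Setoid setoid

  D-0 : D 0# ≈ 0#
  D-0 = identityˡ-unique _ _ (begin
    D 0# + D 0# ≈⟨ D-+ 0# 0# ⟨
    D (0# + 0#) ≈⟨ D-cong (+-identityˡ 0#) ⟩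
    D 0#        ∎)

  D-1 : D 1# ≈ 0#
  D-1 = identityˡ-unique _ _ (begin
    D 1# + D 1#           ≈⟨ +-cong (*-identityʳ _) (*-identityˡ _) ⟨
    D 1# * 1# + 1# * D 1# ≈⟨ D-* 1# 1# ⟨
    D (1# * 1#)           ≈⟨ D-cong (*-identityˡ 1#) ⟩
    D 1#                  ∎)

  D-⟦⟧ : ∀ n → D ⟦ n ⟧ ≈ 0#
  D-⟦⟧ zero    = D-0
  D-⟦⟧ (suc n) = begin
    D (1# + ⟦ n ⟧)   ≈⟨ D-+ 1# ⟦ n ⟧ ⟩
    D 1# + D ⟦ n ⟧   ≈⟨ +-cong D-1 (D-⟦⟧ n) ⟩
    0# + 0#          ≈⟨ +-identityˡ 0# ⟩
    0#               ∎

  D-const* : ∀ {a} f → D a ≈ 0# → D (a * f) ≈ a * D f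
  D-const* {a} f Da≈0 = begin
    D (a * f)         ≈⟨ D-* a f ⟩
    D a * f + a * D f ≈⟨ +-congʳ (trans (*-congʳ Da≈0) (zeroˡ f)) ⟩
    0# + a * D f      ≈⟨ +-identityˡ _ ⟩
    a * D f           ∎

  D-const^ : ∀ {a} n → D a ≈ 0# → D (a ^ n) ≈ 0#
  D-const^ zero    _    = D-1
  D-const^ {a} (suc n) Da≈0 = begin
    D (a * a ^ n)     ≈⟨ D-const* (a ^ n) Da≈0 ⟩
    a * D (a ^ n)     ≈⟨ *-congˡ (D-const^ n Da≈0) ⟩
    a * 0#            ≈⟨ zeroʳ a ⟩
    0#                ∎

  D-sumTo : ∀ n f → D (sumTo n f) ≈ sumTo n (λ k → D (f k))
  D-sumTo zero    f = D-0
  D-sumTo (suc n) f = trans (D-+ _ _) (+-congˡ (D-sumTo n (f ∘ suc)))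

  D^ : ℕ → Carrier → Carrier
  D^ zero    f = f
  D^ (suc n) f = D (D^ n f)

  -- The chain rule for f' = y f^2 / g with `g` cleared. It serves for f = `H`, g = `B`, y = 2x^2,
  -- and with g = 1 it gives `D-^`.
  *-D-^ : ∀ {g f y} → g * D f ≈ y * (f * f) → ∀ n → g * D (f ^ n) ≈ ⟦ n ⟧ * (y * f ^ suc n)
  *-D-^ {g} {f} {y} eq zero    = trans (*-congˡ D-1) (trans (zeroʳ g) (sym (zeroˡ _)))
  *-D-^ {g} {f} {y} eq (suc n) = begin
    g * D (f * f ^ n)                                   ≈⟨ *-congˡ (D-* f (f ^ n)) ⟩
    g * (D f * f ^ n + f * D (f ^ n))
      ≈⟨ solve 5 (λ g f f′ p p′ → g :* (f′ :* p :+ f :* p′) := g :* f′ :* p :+ f :* (g :* p′))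
         refl g f (D f) (f ^ n) (D (f ^ n)) ⟩
    g * D f * f ^ n + f * (g * D (f ^ n))               ≈⟨ +-cong (*-congʳ eq) (*-congˡ (*-D-^ eq n)) ⟩
    y * (f * f) * f ^ n + f * (⟦ n ⟧ * (y * (f * f ^ n)))
      ≈⟨ solve 4 (λ f y p n → y :* (f :* f) :* p :+ f :* (n :* (y :* (f :* p)))
              := (con 1 :+ n) :* (y :* (f :* (f :* p))))
         refl f y (f ^ n) ⟦ n ⟧ ⟩
    (1# + ⟦ n ⟧) * (y * (f * (f * f ^ n)))              ∎

  D-^ : ∀ {f y} → D f ≈ y * (f * f) → ∀ n → D (f ^ n) ≈ ⟦ n ⟧ * (y * f ^ suc n)
  D-^ {f} {y} eq n = trans (sym (*-identityˡ _)) (*-D-^ (trans (*-identityˡ _) eq) n)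

  -- Differentiating q h = 1 gives h' = - q' h^2. The solver knows only semirings, so b q' = - e is
  -- phrased as a vanishing sum, and the term b h q' h is added to both sides and cancelled at the
  -- end.
  D-inverse : ∀ {q h b e} → q * h ≈ 1# → b * D q + e ≈ 0# → b * D h ≈ e * (h * h)
  D-inverse {q} {h} {b} {e} qh≈1 bDq+e≈0 = ∙-cancelʳ (b * h * (D q * h)) _ _ (begin
    b * D h + b * h * (D q * h)             ≈⟨ +-congʳ (trans (*-congʳ qh≈1) (*-identityˡ _)) ⟨
    q * h * (b * D h) + b * h * (D q * h)
      ≈⟨ solve 5 (λ q h b h′ q′ → q :* h :* (b :* h′) :+ b :* h :* (q′ :* h)
              := b :* h :* (q′ :* h :+ q :* h′))
         refl q h b (D h) (D q) ⟩
    b * h * (D q * h + q * D h)             ≈⟨ *-congˡ (D-* q h) ⟨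
    b * h * D (q * h)                       ≈⟨ *-congˡ (trans (D-cong qh≈1) D-1) ⟩
    b * h * 0#                              ≈⟨ solve 2 (λ b h → b :* h :* con 0 := h :* h :* con 0) refl b h ⟩
    h * h * 0#                              ≈⟨ *-congˡ bDq+e≈0 ⟨
    h * h * (b * D q + e)
      ≈⟨ solve 4 (λ h b q′ e → h :* h :* (b :* q′ :+ e) := e :* (h :* h) :+ b :* h :* (q′ :* h))
         refl h b (D q) e ⟩
    e * (h * h) + b * h * (D q * h)         ∎)

  module _ {x B H : Carrier} (Dx≈0 : D x ≈ 0#) (DB≈B² : D B ≈ 1# * (B * B))
           (BDH≈2x²H² : B * D H ≈ ⟦ 2 ⟧ * (x * x) * (H * H)) where

    -- Induction by applying `B * D`. On the left the chain rule brings out 2 (n + 2) x^2 and one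
    -- more power of `H`. With N = n + 1 and i = j + 1, the exponent of `B` is 2N - i.
    power-expansion : ∀ n →
      ⟦ 2 ℕ.^ suc n ℕ.* suc n ! ⟧ * (x ^ (2 ℕ.* suc n) * H ^ suc (suc n)) ≈
      sumTo (suc n) (λ j → ⟦ aℕ n j ⟧ * (B ^ suc (2 ℕ.* n ∸ j) * D^ (suc j) H))
    power-expansion zero = begin
      ⟦ 2 ⟧ * (x * (x * 1#) * (H * (H * 1#)))
        ≈⟨ solve 3 (λ t x H → t :* (x :* (x :* con 1) :* (H :* (H :* con 1))) := t :* (x :* x) :* (H :* H))
           refl ⟦ 2 ⟧ x H ⟩
      ⟦ 2 ⟧ * (x * x) * (H * H)                ≈⟨ BDH≈2x²H² ⟨
      B * D H                                  ≈⟨ *-identityˡ (B * D H) ⟨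
      1# * (B * D H)                           ≈⟨ *-cong ⟦1⟧ (*-congʳ (*-identityʳ B)) ⟨
      ⟦ 1 ⟧ * (B * 1# * D H)                   ≈⟨ +-identityʳ _ ⟨
      ⟦ 1 ⟧ * (B * 1# * D H) + 0#              ∎
    power-expansion (suc n) = begin
      ⟦ 2 ℕ.^ suc (suc n) ℕ.* suc (suc n) ! ⟧ * (x ^ (2 ℕ.* suc (suc n)) * H ^ suc (suc (suc n)))
        ≈⟨ lhs ⟩
      B * D (K * (Y * P))
        ≈⟨ *-congˡ (D-cong (power-expansion n)) ⟩
      B * D (sumTo (suc n) source)
        ≈⟨ *-congˡ (D-sumTo (suc n) source) ⟩
      B * sumTo (suc n) (λ j → D (source j))
        ≈⟨ sumTo-* (suc n) B (λ j → D (source j)) ⟩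
      sumTo (suc n) (λ j → B * D (source j))
        ≈⟨ sumTo-cong (suc n) step ⟩
      sumTo (suc n) (λ j → same j + next j)
        ≈⟨ sumTo-+ (suc n) same next ⟩
      sumTo (suc n) same + sumTo (suc n) next
        -- The sum of `same` is padded by its vanishing term at n + 1, so that dropping `same 0`
        -- leaves as many terms as `next` has.
        ≈⟨ +-congʳ (begin
             sumTo (suc n) same              ≈⟨ +-identityʳ _ ⟨
             sumTo (suc n) same + 0#         ≈⟨ +-congˡ same-last ⟨
             sumTo (suc n) same + same (suc n) ≈⟨ sumTo-last (suc n) same ⟨
             sumTo (suc (suc n)) same        ∎) ⟩
      same 0 + sumTo (suc n) (same ∘ suc) + sumTo (suc n) next
        ≈⟨ +-assoc _ _ _ ⟩
      same 0 + (sumTo (suc n) (same ∘ suc) + sumTo (suc n) next)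
        ≈⟨ +-congˡ (sumTo-+ (suc n) (same ∘ suc) next) ⟨
      same 0 + sumTo (suc n) (λ j → same (suc j) + next j)
        ≈⟨ +-cong same-first (sumTo-cong (suc n) regroup) ⟩
      sumTo (suc (suc n)) target
        ∎
      where
      N = 2 ℕ.* n
      K = ⟦ 2 ℕ.^ suc n ℕ.* suc n ! ⟧
      Y = x ^ (2 ℕ.* suc n)
      P = H ^ suc (suc n)
      -- `B * D` turns `source j` into `same j + next j`, according to whether the derivative falls
      -- on the power of `B` or on the derivative of `H`. Both `same (suc j)` and `next j`
      -- contribute to `target (suc j)`.
      source same next target : ℕ → Carrier
      source j = ⟦ aℕ n j ⟧ * (B ^ suc (N ∸ j) * D^ (suc j) H)
      same j = ⟦ (N ℕ.+ 1 ∸ j) ℕ.* aℕ n j ⟧ * (B ^ (3 ℕ.+ N ∸ j) * D^ (suc j) H)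
      next j = ⟦ aℕ n j ⟧ * (B ^ (2 ℕ.+ N ∸ j) * D^ (suc (suc j)) H)
      target j = ⟦ aℕ (suc n) j ⟧ * (B ^ suc (2 ℕ.* suc n ∸ j) * D^ (suc j) H)

      c-suc : ∀ n → 2 ℕ.^ suc (suc n) ℕ.* suc (suc n) ! ≡ 2 ℕ.* suc (suc n) ℕ.* (2 ℕ.^ suc n ℕ.* suc n !)
      c-suc n = gen (2 ℕ.^ suc n) (suc (suc n)) (suc n !)
        where
        gen : ∀ a b c → 2 ℕ.* a ℕ.* (b ℕ.* c) ≡ 2 ℕ.* b ℕ.* (a ℕ.* c)
        gen = ℕ-solve-∀

      lhs : ⟦ 2 ℕ.^ suc (suc n) ℕ.* suc (suc n) ! ⟧ * (x ^ (2 ℕ.* suc (suc n)) * H ^ suc (suc (suc n))) ≈ B * D (K * (Y * P))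
      lhs = begin
        ⟦ 2 ℕ.^ suc (suc n) ℕ.* suc (suc n) ! ⟧ * (x ^ (2 ℕ.* suc (suc n)) * H ^ suc (suc (suc n)))
          ≈⟨ *-cong (trans (⟦⟧-cong (c-suc n)) (trans (⟦⟧-* (2 ℕ.* suc (suc n)) (2 ℕ.^ suc n ℕ.* suc n !)) (*-congʳ (⟦⟧-* 2 (suc (suc n))))))
                    (*-congʳ (^-cong refl (ℕₚ.*-suc 2 (suc n)))) ⟩
        ⟦ 2 ⟧ * ⟦ suc (suc n) ⟧ * K * (x * (x * Y) * H ^ suc (suc (suc n)))
          ≈⟨ solve 6 (λ t m c x y h → t :* m :* c :* (x :* (x :* y) :* h)
                  := c :* (y :* (m :* (t :* (x :* x) :* h))))
               refl ⟦ 2 ⟧ ⟦ suc (suc n) ⟧ K x Y (H ^ suc (suc (suc n))) ⟩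
        K * (Y * (⟦ suc (suc n) ⟧ * (⟦ 2 ⟧ * (x * x) * H ^ suc (suc (suc n)))))
          ≈⟨ *-congˡ (*-congˡ (*-D-^ BDH≈2x²H² (suc (suc n)))) ⟨
        K * (Y * (B * D P))
          ≈⟨ solve 4 (λ c y b d → c :* (y :* (b :* d)) := b :* (c :* (y :* d))) refl K Y B (D P) ⟩
        B * (K * (Y * D P))
          ≈⟨ *-congˡ (*-congˡ (D-const* P (D-const^ (2 ℕ.* suc n) Dx≈0))) ⟨
        B * (K * D (Y * P))
          ≈⟨ *-congˡ (D-const* (Y * P) (D-⟦⟧ (2 ℕ.^ suc n ℕ.* suc n !))) ⟨
        B * D (K * (Y * P)) ∎

      step : ∀ j → j < suc n → B * D (source j) ≈ same j + next j
      step j (s≤s j≤n) = begin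
        B * D (⟦ aℕ n j ⟧ * (B ^ suc e * d))
          ≈⟨ *-congˡ (D-const* _ (D-⟦⟧ (aℕ n j))) ⟩
        B * (⟦ aℕ n j ⟧ * D (B ^ suc e * d))
          ≈⟨ *-congˡ (*-congˡ (D-* (B ^ suc e) d)) ⟩
        B * (⟦ aℕ n j ⟧ * (D (B ^ suc e) * d + B ^ suc e * D d))
          ≈⟨ *-congˡ (*-congˡ (+-congʳ (*-congʳ (D-^ DB≈B² (suc e))))) ⟩
        B * (⟦ aℕ n j ⟧ * (⟦ suc e ⟧ * (1# * B ^ suc (suc e)) * d + B ^ suc e * D d))
          ≈⟨ solve 6 (λ b a s p d d′ → b :* (a :* (s :* (con 1 :* (b :* p)) :* d :+ p :* d′))
                  := s :* a :* (b :* (b :* p) :* d) :+ a :* (b :* p :* d′))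
               refl B ⟦ aℕ n j ⟧ ⟦ suc e ⟧ (B ^ suc e) d (D d) ⟩
        ⟦ suc e ⟧ * ⟦ aℕ n j ⟧ * (B ^ (3 ℕ.+ e) * d) + ⟦ aℕ n j ⟧ * (B ^ (2 ℕ.+ e) * D d)
          ≈⟨ +-cong (*-cong (trans (sym (⟦⟧-* (suc e) (aℕ n j)))
                                   (⟦⟧-cong (≡.cong (ℕ._* aℕ n j) (≡.trans (≡.sym (ℕₚ.+-∸-assoc 1 j≤N)) (≡.cong (_∸ j) (ℕₚ.+-comm 1 N))))))
                            (*-congʳ (^-cong refl (≡.sym (ℕₚ.+-∸-assoc 3 j≤N)))))
                    (*-congˡ (*-congʳ (^-cong refl (≡.sym (ℕₚ.+-∸-assoc 2 j≤N))))) ⟩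
        same j + next j ∎
        where
        e = N ∸ j
        d = D^ (suc j) H
        j≤N : j ≤ N
        j≤N = ℕₚ.≤-trans j≤n (ℕₚ.m≤m+n n _)

      same-last : same (suc n) ≈ 0#
      same-last = trans (*-congʳ (⟦⟧-cong (≡.trans (≡.cong ((2 ℕ.* n ℕ.+ 1 ∸ suc n) ℕ.*_) (aℕ-zero (ℕₚ.n<1+n n)))
                                                  (ℕₚ.*-zeroʳ (2 ℕ.* n ℕ.+ 1 ∸ suc n)))))
                        (zeroˡ _)

      same-first : same 0 ≈ target 0
      same-first = *-congˡ (*-congʳ (^-cong refl (≡.cong suc (≡.sym (ℕₚ.*-suc 2 n)))))

      regroup : ∀ j → j < suc n → same (suc j) + next j ≈ target (suc j)
      regroup j (s≤s j≤n) = begin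
        same (suc j) + next j
          ≈⟨ distribʳ _ _ _ ⟨
        (⟦ (2 ℕ.* n ℕ.+ 1 ∸ suc j) ℕ.* aℕ n (suc j) ⟧ + ⟦ aℕ n j ⟧) * (B ^ (2 ℕ.+ N ∸ j) * D^ (suc (suc j)) H)
          ≈⟨ *-cong (trans (sym (⟦⟧-+ ((N ℕ.+ 1 ∸ suc j) ℕ.* aℕ n (suc j)) (aℕ n j))) (⟦⟧-cong (≡.cong (λ m → (m ∸ suc j) ℕ.* aℕ n (suc j) ℕ.+ aℕ n j) (ℕₚ.+-comm N 1))))
                    (*-congʳ (^-cong refl exponent)) ⟩
        target (suc j) ∎
        where
        exponent : 2 ℕ.+ N ∸ j ≡ suc (2 ℕ.* suc n ∸ suc j)
        exponent = ≡.trans (ℕₚ.+-∸-assoc 1 {suc N} {j} (ℕₚ.m≤n⇒m≤1+n (ℕₚ.≤-trans j≤n (ℕₚ.m≤m+n n _))))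
                           (≡.cong (λ m → suc (m ∸ suc j)) (≡.sym (ℕₚ.*-suc 2 n)))

  module _ {x E F : Carrier} (Dx≈0 : D x ≈ 0#) (DE≈xE² : D E ≈ x * (E * E)) where

    -- For E = 1/(1 - xu) this is the (i+1)-st derivative of (1 - xu) (E F) = F: as 1 - xu is
    -- linear, only two Leibniz terms survive.
    leibniz-suc : ∀ i → D^ (suc i) (E * F) ≈ E * (D^ (suc i) F + ⟦ suc i ⟧ * (x * D^ i (E * F)))
    leibniz-suc zero = begin
      D (E * F)                                ≈⟨ D-* E F ⟩
      D E * F + E * D F                        ≈⟨ +-congʳ (*-congʳ DE≈xE²) ⟩
      x * (E * E) * F + E * D F
        ≈⟨ solve 4 (λ x e f f′ → x :* (e :* e) :* f :+ e :* f′
                := e :* (f′ :+ (con 1 :+ con 0) :* (x :* (e :* f))))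
           refl x E F (D F) ⟩
      E * (D F + (1# + 0#) * (x * (E * F)))    ∎
    leibniz-suc (suc i) = begin
      D (D^ (suc i) (E * F))
        ≈⟨ D-cong (leibniz-suc i) ⟩
      D (E * (f + ⟦ suc i ⟧ * (x * h)))
        ≈⟨ D-* E _ ⟩
      D E * (f + ⟦ suc i ⟧ * (x * h)) + E * D (f + ⟦ suc i ⟧ * (x * h))
        ≈⟨ +-cong (*-congʳ DE≈xE²) (*-congˡ (trans (D-+ f _) (+-congˡ (trans (D-const* _ (D-⟦⟧ (suc i))) (*-congˡ (D-const* h Dx≈0)))))) ⟩
      x * (E * E) * (f + ⟦ suc i ⟧ * (x * h)) + E * (D f + ⟦ suc i ⟧ * (x * D h))
        ≈⟨ solve 6 (λ x e y f n h → x :* (e :* e) :* y :+ e :* (f :+ n :* (x :* h))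
                := e :* (f :+ (x :* (e :* y) :+ n :* (x :* h))))
             refl x E (f + ⟦ suc i ⟧ * (x * h)) (D f) ⟦ suc i ⟧ (D h) ⟩
      E * (D f + (x * (E * (f + ⟦ suc i ⟧ * (x * h))) + ⟦ suc i ⟧ * (x * D h)))
        ≈⟨ *-congˡ (+-congˡ (+-congʳ (*-congˡ (leibniz-suc i)))) ⟨
      E * (D f + (x * D h + ⟦ suc i ⟧ * (x * D h)))
        ≈⟨ solve 4 (λ e f h n → e :* (f :+ (h :+ n :* h)) := e :* (f :+ (con 1 :+ n) :* h))
             refl E (D f) (x * D h) ⟦ suc i ⟧ ⟩
      E * (D f + (1# + ⟦ suc i ⟧) * (x * D h)) ∎
      where
      f = D^ (suc i) F
      h = D^ i (E * F)

    -- The d-th derivative of E is d! x^d E^(d+1), and binom(i, l) (i - l)! = i!/l!. Unrolling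
    -- `leibniz-suc` produces this quotient directly, without passing through binomial coefficients.
    leibniz : ∀ i → D^ i (E * F) ≈
      sumTo (suc i) (λ l → ⟦ quotient-! l (i ∸ l) ⟧ * (x ^ (i ∸ l) * E ^ suc (i ∸ l) * D^ l F))
    leibniz zero = solve 2 (λ e f → e :* f := (con 1 :+ con 0) :* (con 1 :* (e :* con 1) :* f) :+ con 0)
         refl E F
    leibniz (suc i) = begin
      D^ (suc i) (E * F)
        ≈⟨ leibniz-suc i ⟩
      E * (D^ (suc i) F + ⟦ suc i ⟧ * (x * D^ i (E * F)))
        ≈⟨ solve 5 (λ e f n x h → e :* (f :+ n :* (x :* h))
                := n :* (x :* e) :* h :+ (con 1 :+ con 0) :* (con 1 :* (e :* con 1) :* f))
             refl E (D^ (suc i) F) ⟦ suc i ⟧ x (D^ i (E * F)) ⟩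
      ⟦ suc i ⟧ * (x * E) * D^ i (E * F) + (1# + 0#) * (1# * (E * 1#) * D^ (suc i) F)
        ≈⟨ +-cong (*-congˡ (leibniz i)) (reflexive (≡.cong (λ d → ⟦ quotient-! (suc i) d ⟧ * (x ^ d * E ^ suc d * D^ (suc i) F)) (≡.sym (ℕₚ.n∸n≡0 i)))) ⟩
      ⟦ suc i ⟧ * (x * E) * sumTo (suc i) (term i) + term (suc i) (suc i)
        ≈⟨ +-congʳ (trans (sumTo-* (suc i) (⟦ suc i ⟧ * (x * E)) (term i)) (sumTo-cong (suc i) raise)) ⟩
      sumTo (suc i) (term (suc i)) + term (suc i) (suc i)
        ≈⟨ sumTo-last (suc i) (term (suc i)) ⟨
      sumTo (suc (suc i)) (term (suc i)) ∎
      where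
      term : ℕ → ℕ → Carrier
      term i l = ⟦ quotient-! l (i ∸ l) ⟧ * (x ^ (i ∸ l) * E ^ suc (i ∸ l) * D^ l F)
      raise : ∀ l → l < suc i → ⟦ suc i ⟧ * (x * E) * term i l ≈ term (suc i) l
      raise l (s≤s l≤i) = begin
        ⟦ suc i ⟧ * (x * E) * term i l
          ≈⟨ solve 7 (λ n x e q y z f → n :* (x :* e) :* (q :* (y :* z :* f))
                  := n :* q :* (x :* y :* (e :* z) :* f))
               refl ⟦ suc i ⟧ x E ⟦ quotient-! l d ⟧ (x ^ d) (E ^ suc d) (D^ l F) ⟩
        ⟦ suc i ⟧ * ⟦ quotient-! l d ⟧ * (x ^ suc d * E ^ suc (suc d) * D^ l F)
          ≈⟨ *-congʳ (trans (sym (⟦⟧-* (suc i) (quotient-! l d))) (⟦⟧-cong (≡.cong (ℕ._* quotient-! l d) (≡.sym l+1+d≡1+i)))) ⟩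
        ⟦ quotient-! l (suc d) ⟧ * (x ^ suc d * E ^ suc (suc d) * D^ l F)
          ≈⟨ reflexive (≡.cong (λ d → ⟦ quotient-! l d ⟧ * (x ^ d * E ^ suc d * D^ l F)) (≡.sym (ℕₚ.+-∸-assoc 1 l≤i))) ⟩
        term (suc i) l ∎
        where
        d = i ∸ l
        l+1+d≡1+i : l ℕ.+ suc d ≡ suc i
        l+1+d≡1+i = ≡.trans (ℕₚ.+-suc l d) (≡.cong suc (ℕₚ.m+[n∸m]≡n l≤i))

-- Formal power series

ℕ-rearrange : ∀ d s r l → d ℕ.+ (s ℕ.+ (r ℕ.+ l)) ≡ d ℕ.+ l ℕ.+ (s ℕ.+ r)
ℕ-rearrange = ℕ-solve-∀

-- (p + 1) ... (p + l), which is the falling factorial (p + l)_l. The lowest factor is split off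
-- first, matching the outermost derivative in `D^-at`.
risingFactorial : ℕ → ℕ → ℕ
risingFactorial p zero    = 1
risingFactorial p (suc l) = suc p ℕ.* risingFactorial (suc p) l

module FormalPowerSeries {c ℓ} (R : CommutativeRing c ℓ) where
  open CommutativeRing R hiding (zero)
  open Ranges R
  open Exp semiring using (_^_; ^-homo-*; ^-cong)
  open Sum semiring using (sum; sum-cong-≋)
  open import Relation.Binary.Reasoning.Setoid setoid
  private module P = PowerSeries rawRing
  open P using (Series; one; mul) public

  infix 4 _≋_
  _≋_ : Series → Series → Set ℓ
  f ≋ g = ∀ n → f n ≈ g n

  mul-cong : ∀ {f f′ g g′} → f ≋ f′ → g ≋ g′ → mul f g ≋ mul f′ g′
  mul-cong {f} {f′} {g} {g′} f≋f′ g≋g′ n =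
    sumTo-cong (suc n) {λ k → f k * g (n ∸ k)} {λ k → f′ k * g′ (n ∸ k)} (λ k _ → *-cong (f≋f′ k) (g≋g′ (n ∸ k)))

  mul-zeroˡ : ∀ f → mul (λ _ → 0#) f ≋ (λ _ → 0#)
  mul-zeroˡ f zero    = solve 1 (λ f → con 0 :* f :+ con 0 := con 0) refl (f 0)
  mul-zeroˡ f (suc n) = trans (+-cong (zeroˡ _) (mul-zeroˡ f n)) (+-identityˡ 0#)

  mul-scaleˡ : ∀ a f g → mul (λ k → a * f k) g ≋ (λ n → a * mul f g n)
  mul-scaleˡ a f g zero    = solve 3 (λ a f g → a :* f :* g :+ con 0 := a :* (f :* g :+ con 0))
       refl a (f 0) (g 0)
  mul-scaleˡ a f g (suc n) = begin
    a * f 0 * g (suc n) + mul (λ k → a * f (suc k)) g n ≈⟨ +-congˡ (mul-scaleˡ a (f ∘ suc) g n) ⟩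
    a * f 0 * g (suc n) + a * mul (f ∘ suc) g n
      ≈⟨ solve 4 (λ a f g m → a :* f :* g :+ a :* m := a :* (f :* g :+ m))
         refl a (f 0) (g (suc n)) (mul (f ∘ suc) g n) ⟩
    a * mul f g (suc n)                                 ∎

  mul-distribʳ : ∀ h f g → mul (λ k → f k + g k) h ≋ (λ n → mul f h n + mul g h n)
  mul-distribʳ h f g zero    = solve 3 (λ h f g → (f :+ g) :* h :+ con 0
          := f :* h :+ con 0 :+ (g :* h :+ con 0))
       refl (h 0) (f 0) (g 0)
  mul-distribʳ h f g (suc n) = begin
    (f 0 + g 0) * h (suc n) + mul (λ k → f (suc k) + g (suc k)) h n
      ≈⟨ +-congˡ (mul-distribʳ h (f ∘ suc) (g ∘ suc) n) ⟩
    (f 0 + g 0) * h (suc n) + (mul (f ∘ suc) h n + mul (g ∘ suc) h n)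
      ≈⟨ solve 5 (λ f g h a b → (f :+ g) :* h :+ (a :+ b) := f :* h :+ a :+ (g :* h :+ b))
           refl (f 0) (g 0) (h (suc n)) (mul (f ∘ suc) h n) (mul (g ∘ suc) h n) ⟩
    mul f h (suc n) + mul g h (suc n) ∎

  mul-last : ∀ f g n → mul f g (suc n) ≈ mul f (g ∘ suc) n + f (suc n) * g 0
  mul-last f g zero    = solve 2 (λ a b → a :+ (b :+ con 0) := a :+ con 0 :+ b) refl (f 0 * g 1) (f 1 * g 0)
  mul-last f g (suc n) = trans (+-congˡ (mul-last (f ∘ suc) g n)) (sym (+-assoc _ _ _))

  mul-comm : ∀ f g → mul f g ≋ mul g f
  mul-comm f g zero    = +-congʳ (*-comm (f 0) (g 0))
  mul-comm f g (suc n) = begin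
    f 0 * g (suc n) + mul (f ∘ suc) g n ≈⟨ +-cong (*-comm (f 0) _) (mul-comm (f ∘ suc) g n) ⟩
    g (suc n) * f 0 + mul g (f ∘ suc) n ≈⟨ +-comm _ _ ⟩
    mul g (f ∘ suc) n + g (suc n) * f 0 ≈⟨ mul-last g f n ⟨
    mul g f (suc n)                     ∎

  mul-assoc : ∀ f g h → mul (mul f g) h ≋ mul f (mul g h)
  mul-assoc f g h zero    = solve 3 (λ f g h → (f :* g :+ con 0) :* h :+ con 0
          := f :* (g :* h :+ con 0) :+ con 0)
       refl (f 0) (g 0) (h 0)
  mul-assoc f g h (suc n) = begin
    mul f g 0 * h (suc n) + mul (λ k → f 0 * g (suc k) + mul (f ∘ suc) g k) h n
      ≈⟨ +-congˡ (mul-distribʳ h (λ k → f 0 * g (suc k)) (mul (f ∘ suc) g) n) ⟩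
    mul f g 0 * h (suc n) + (mul (λ k → f 0 * g (suc k)) h n + mul (mul (f ∘ suc) g) h n)
      ≈⟨ +-congˡ (+-cong (mul-scaleˡ (f 0) (g ∘ suc) h n) (mul-assoc (f ∘ suc) g h n)) ⟩
    mul f g 0 * h (suc n) + (f 0 * mul (g ∘ suc) h n + mul (f ∘ suc) (mul g h) n)
      ≈⟨ solve 5 (λ f g h a b → (f :* g :+ con 0) :* h :+ (f :* a :+ b) := f :* (g :* h :+ a) :+ b)
           refl (f 0) (g 0) (h (suc n)) (mul (g ∘ suc) h n) (mul (f ∘ suc) (mul g h) n) ⟩
    mul f (mul g h) (suc n) ∎

  mul-identityˡ : ∀ f → mul one f ≋ f
  mul-identityˡ f zero    = solve 1 (λ f → con 1 :* f :+ con 0 := f) refl (f 0)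
  mul-identityˡ f (suc n) = trans (+-cong (*-identityˡ _) (mul-zeroˡ f n)) (+-identityʳ _)

  mul-isCommutativeRing : IsCommutativeRing _≋_ (λ f g n → f n + g n) mul (λ f n → - f n) (λ _ → 0#) one
  mul-isCommutativeRing = record
    { isRing = record
      { +-isAbelianGroup = Pointwise.isAbelianGroup ℕ +-isAbelianGroup
      ; *-cong     = mul-cong
      ; *-assoc    = mul-assoc
      ; *-identity = mul-identityˡ , λ f n → trans (mul-comm f one n) (mul-identityˡ f n)
      ; distrib    = (λ h f g n → trans (mul-comm h (λ k → f k + g k) n) (trans (mul-distribʳ h f g n)
                                   (+-cong (mul-comm f h n) (mul-comm g h n))))
                   , mul-distribʳ
      }
    ; *-comm = mul-comm
    }

  seriesRing : CommutativeRing c ℓ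
  seriesRing = record { isCommutativeRing = mul-isCommutativeRing }

  module S = CommutativeRing seriesRing
  module SRanges = Ranges seriesRing
  module SExp = CommutativeExp S.commutativeSemiring

  -- The prefix is stored in reverse, so its k-th entry is the coefficient that `f (suc k)` meets in
  -- the product. The remaining term has factor f 0 = 1 and was defined to make up the difference to
  -- `g n`.
  quotient-* : ∀ g f (monic : f 0 ≡ 1#) → mul f (P.quotient g f monic) ≋ g
  quotient-* g f monic n = begin
    mul f h n                 ≈⟨ peel n ⟩
    f 0 * h n + rest n        ≈⟨ +-congʳ (trans (*-congʳ (reflexive monic)) (*-identityˡ _)) ⟩
    g n + - rest n + rest n   ≈⟨ +-assoc _ _ _ ⟩
    g n + (- rest n + rest n) ≈⟨ +-congˡ (-‿inverseˡ _) ⟩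
    g n + 0#                  ≈⟨ +-identityʳ _ ⟩
    g n                       ∎
    where
    h = P.quotient g f monic
    rest : ℕ → Carrier
    rest n = sum (λ k → f (suc (toℕ k)) * Vec.lookup (P.quotientPrefix g f monic n) k)
    lookup-prefix : ∀ n (k : Fin n) → Vec.lookup (P.quotientPrefix g f monic n) k ≡ h (n ∸ suc (toℕ k))
    lookup-prefix (suc n) Fin.zero    = ≡.refl
    lookup-prefix (suc n) (Fin.suc k) = lookup-prefix n k
    peel : ∀ n → mul f h n ≈ f 0 * h n + rest n
    peel zero    = refl
    peel (suc n) = +-congˡ (sum-cong-≋ (λ k → *-congˡ {f (suc (toℕ k))} (reflexive (≡.sym (lookup-prefix (suc n) k)))))

  sumTo-at : ∀ m (F : ℕ → Series) n → SRanges.sumTo m F n ≈ sumTo m (λ k → F k n)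
  sumTo-at zero    F n = refl
  sumTo-at (suc m) F n = +-congˡ (sumTo-at m (F ∘ suc) n)

  const : Carrier → Series
  const a zero    = a
  const a (suc _) = 0#

  const-*-at : ∀ a f → mul (const a) f ≋ (λ n → a * f n)
  const-*-at a f zero    = +-identityʳ _
  const-*-at a f (suc n) = trans (+-congˡ (mul-zeroˡ f n)) (+-identityʳ _)

  const-* : ∀ a b → const (a * b) ≋ mul (const a) (const b)
  const-* a b zero    = sym (+-identityʳ _)
  const-* a b (suc n) = sym (trans (const-*-at a (const b) (suc n)) (zeroʳ a))

  const-1 : const 1# ≋ one
  const-1 zero    = refl
  const-1 (suc n) = refl

  const-^ : ∀ a n → const (a ^ n) ≋ const a SExp.^ n
  const-^ a zero    = const-1
  const-^ a (suc n) = S.trans (const-* a (a ^ n)) (S.*-congˡ {const a} (const-^ a n))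

  const-⟦⟧ : ∀ n → const ⟦ n ⟧ ≋ SRanges.⟦ n ⟧
  const-⟦⟧ zero    zero    = refl
  const-⟦⟧ zero    (suc k) = refl
  const-⟦⟧ (suc n) zero    = +-congˡ (const-⟦⟧ n zero)
  const-⟦⟧ (suc n) (suc k) = sym (trans (+-congˡ (sym (const-⟦⟧ n (suc k)))) (+-identityˡ 0#))

  ⟦⟧-*-at : ∀ m f n → mul SRanges.⟦ m ⟧ f n ≈ ⟦ m ⟧ * f n
  ⟦⟧-*-at m f n = trans (mul-cong {g = f} (S.sym (const-⟦⟧ m)) S.refl n) (const-*-at ⟦ m ⟧ f n)

  const-^-*-at : ∀ a m f n → mul (const a SExp.^ m) f n ≈ a ^ m * f n
  const-^-*-at a m f n = trans (mul-cong {g = f} (S.sym (const-^ a m)) S.refl n) (const-*-at (a ^ m) f n)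

  D : Series → Series
  D f n = ⟦ suc n ⟧ * f (suc n)

  -- The Leibniz rule for t d/dt, of which D is the shift.
  weighted-mul : ∀ f g n → ⟦ n ⟧ * mul f g n ≈ mul (λ k → ⟦ k ⟧ * f k) g n + mul f (λ k → ⟦ k ⟧ * g k) n
  weighted-mul f g n = begin
    ⟦ n ⟧ * mul f g n
      ≈⟨ sumTo-* (suc n) ⟦ n ⟧ (λ k → f k * g (n ∸ k)) ⟩
    sumTo (suc n) (λ k → ⟦ n ⟧ * (f k * g (n ∸ k)))
      ≈⟨ sumTo-cong (suc n) split ⟩
    sumTo (suc n) (λ k → ⟦ k ⟧ * f k * g (n ∸ k) + f k * (⟦ n ∸ k ⟧ * g (n ∸ k)))
      ≈⟨ sumTo-+ (suc n) (λ k → ⟦ k ⟧ * f k * g (n ∸ k)) (λ k → f k * (⟦ n ∸ k ⟧ * g (n ∸ k))) ⟩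
    mul (λ k → ⟦ k ⟧ * f k) g n + mul f (λ k → ⟦ k ⟧ * g k) n ∎
    where
    split : ∀ k → k < suc n → ⟦ n ⟧ * (f k * g (n ∸ k)) ≈ ⟦ k ⟧ * f k * g (n ∸ k) + f k * (⟦ n ∸ k ⟧ * g (n ∸ k))
    split k (s≤s k≤n) = begin
      ⟦ n ⟧ * (f k * g (n ∸ k))
        ≈⟨ *-congʳ (trans (⟦⟧-cong (≡.sym (ℕₚ.m+[n∸m]≡n k≤n))) (⟦⟧-+ k (n ∸ k))) ⟩
      (⟦ k ⟧ + ⟦ n ∸ k ⟧) * (f k * g (n ∸ k))
        ≈⟨ solve 4 (λ a b f g → (a :+ b) :* (f :* g) := a :* f :* g :+ f :* (b :* g))
             refl ⟦ k ⟧ ⟦ n ∸ k ⟧ (f k) (g (n ∸ k)) ⟩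
      ⟦ k ⟧ * f k * g (n ∸ k) + f k * (⟦ n ∸ k ⟧ * g (n ∸ k)) ∎

  D-isDerivation : IsDerivation seriesRing D
  D-isDerivation = record
    { D-cong = λ f≋g n → *-congˡ (f≋g (suc n))
    ; D-+    = λ f g n → distribˡ _ _ _
    -- In degree n + 1 of `weighted-mul` the terms of weight 0, first in one product and last in the
    -- other, drop out; the others are the products with a derivative.
    ; D-*    = λ f g n → begin
        ⟦ suc n ⟧ * mul f g (suc n)
          ≈⟨ weighted-mul f g (suc n) ⟩
        0# * f 0 * g (suc n) + mul (D f) g n + mul f (λ k → ⟦ k ⟧ * g k) (suc n)
          ≈⟨ +-congˡ (mul-last f (λ k → ⟦ k ⟧ * g k) n) ⟩
        0# * f 0 * g (suc n) + mul (D f) g n + (mul f (D g) n + f (suc n) * (0# * g 0))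
          ≈⟨ solve 6 (λ a b c d x y → con 0 :* a :* b :+ x :+ (y :+ c :* (con 0 :* d)) := x :+ y) refl
               (f 0) (g (suc n)) (f (suc n)) (g 0) (mul (D f) g n) (mul f (D g) n) ⟩
        mul (D f) g n + mul f (D g) n ∎
    }

  open Differential seriesRing D D-isDerivation

  D-const : ∀ a → D (const a) ≋ S.0#
  D-const a n = zeroʳ _

  D^-at : ∀ l f p → D^ l f p ≈ ⟦ risingFactorial p l ⟧ * f (p ℕ.+ l)
  D^-at zero    f p = begin
    f p                 ≈⟨ reflexive (≡.cong f (≡.sym (ℕₚ.+-identityʳ p))) ⟩
    f (p ℕ.+ 0)         ≈⟨ *-identityˡ _ ⟨
    1# * f (p ℕ.+ 0)    ≈⟨ *-congʳ ⟦1⟧ ⟨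
    ⟦ 1 ⟧ * f (p ℕ.+ 0) ∎
  D^-at (suc l) f p = begin
    ⟦ suc p ⟧ * D^ l f (suc p)
      ≈⟨ *-congˡ (D^-at l f (suc p)) ⟩
    ⟦ suc p ⟧ * (⟦ risingFactorial (suc p) l ⟧ * f (suc p ℕ.+ l))
      ≈⟨ *-assoc _ _ _ ⟨
    ⟦ suc p ⟧ * ⟦ risingFactorial (suc p) l ⟧ * f (suc p ℕ.+ l)
      ≈⟨ *-cong (sym (⟦⟧-* (suc p) (risingFactorial (suc p) l))) (reflexive (≡.cong f (≡.sym (ℕₚ.+-suc p l)))) ⟩
    ⟦ risingFactorial p (suc l) ⟧ * f (p ℕ.+ suc l) ∎

  -- The substitution t = xu; by `scale-mul` and `scale-one` it is multiplicative.
  scale : Carrier → Series → Series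
  scale x f n = x ^ n * f n

  scale-mul : ∀ x f g → scale x (mul f g) ≋ mul (scale x f) (scale x g)
  scale-mul x f g n = trans (sumTo-* (suc n) (x ^ n) (λ k → f k * g (n ∸ k))) (sumTo-cong (suc n) split)
    where
    split : ∀ k → k < suc n → x ^ n * (f k * g (n ∸ k)) ≈ x ^ k * f k * (x ^ (n ∸ k) * g (n ∸ k))
    split k (s≤s k≤n) = begin
      x ^ n * (f k * g (n ∸ k))
        ≈⟨ *-congʳ (trans (^-cong refl (≡.sym (ℕₚ.m+[n∸m]≡n k≤n))) (^-homo-* x k (n ∸ k))) ⟩
      x ^ k * x ^ (n ∸ k) * (f k * g (n ∸ k))
        ≈⟨ solve 4 (λ a b f g → a :* b :* (f :* g) := a :* f :* (b :* g))
             refl (x ^ k) (x ^ (n ∸ k)) (f k) (g (n ∸ k)) ⟩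
      x ^ k * f k * (x ^ (n ∸ k) * g (n ∸ k)) ∎

  scale-one : ∀ x → scale x one ≋ one
  scale-one x zero    = *-identityˡ 1#
  scale-one x (suc n) = zeroʳ _

  scale-^ : ∀ x f n → scale x (f SExp.^ n) ≋ scale x f SExp.^ n
  scale-^ x f zero    = scale-one x
  scale-^ x f (suc n) = S.trans (scale-mul x f (f SExp.^ n)) (S.*-congˡ {scale x f} (scale-^ x f n))

  1^ : ∀ n → 1# ^ n ≈ 1#
  1^ zero    = refl
  1^ (suc n) = trans (*-identityˡ _) (1^ n)

  geometric : Carrier → Series
  geometric y n = y ^ n

  -- The quotient h = f / (1 - yu) satisfies h = f + y u h.
  geometric-*-suc : ∀ y f n → mul (geometric y) f (suc n) ≈ f (suc n) + y * mul (geometric y) f n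
  geometric-*-suc y f n = +-cong (*-identityˡ _) (mul-scaleˡ y (geometric y) f n)

  -- The binomial series of (1 - yu)^(-k-1). Dividing once more by 1 - yu is the recursion
  -- `geometric-*-suc`, which on coefficients is Pascal's rule.
  geometric-^ : ∀ y k n → (geometric y SExp.^ suc k) n ≈ ⟦ (k ℕ.+ n) C n ⟧ * y ^ n
  geometric-^ y zero    n = begin
    mul (geometric y) one n ≈⟨ S.*-identityʳ (geometric y) n ⟩
    y ^ n                   ≈⟨ *-identityˡ _ ⟨
    1# * y ^ n              ≈⟨ *-congʳ (trans (⟦⟧-cong (nCn≡1 n)) ⟦1⟧) ⟨
    ⟦ n C n ⟧ * y ^ n       ∎
  geometric-^ y (suc k) zero    = begin
    1# * (geometric y SExp.^ suc k) 0 + 0# ≈⟨ +-congʳ (*-congˡ (geometric-^ y k 0)) ⟩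
    1# * (⟦ (k ℕ.+ 0) C 0 ⟧ * 1#) + 0#     ≈⟨ solve 1 (λ a → con 1 :* (a :* con 1) :+ con 0 := a :* con 1)
         refl ⟦ (k ℕ.+ 0) C 0 ⟧ ⟩
    ⟦ (k ℕ.+ 0) C 0 ⟧ * 1#
      ≈⟨ *-congʳ (⟦⟧-cong (≡.trans (C0 (k ℕ.+ 0)) (≡.sym (C0 (suc k ℕ.+ 0))))) ⟩
    ⟦ (suc k ℕ.+ 0) C 0 ⟧ * 1#             ∎
    where
    C0 : ∀ n → n C 0 ≡ 1
    C0 n = ≡.trans (nCk≡nC[n∸k] {0} {n} z≤n) (nCn≡1 n)
  geometric-^ y (suc k) (suc n) = begin
    mul (geometric y) (geometric y SExp.^ suc k) (suc n)
      ≈⟨ geometric-*-suc y (geometric y SExp.^ suc k) n ⟩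
    (geometric y SExp.^ suc k) (suc n) + y * (geometric y SExp.^ suc (suc k)) n
      ≈⟨ +-cong (geometric-^ y k (suc n)) (*-congˡ (geometric-^ y (suc k) n)) ⟩
    ⟦ (k ℕ.+ suc n) C suc n ⟧ * (y * y ^ n) + y * (⟦ suc (k ℕ.+ n) C n ⟧ * y ^ n)
      ≈⟨ solve 4 (λ a b y p → a :* (y :* p) :+ y :* (b :* p) := (b :+ a) :* (y :* p))
           refl ⟦ (k ℕ.+ suc n) C suc n ⟧ ⟦ suc (k ℕ.+ n) C n ⟧ y (y ^ n) ⟩
    (⟦ suc (k ℕ.+ n) C n ⟧ + ⟦ (k ℕ.+ suc n) C suc n ⟧) * (y * y ^ n)
      ≈⟨ *-congʳ (trans (sym (⟦⟧-+ (suc (k ℕ.+ n) C n) ((k ℕ.+ suc n) C suc n))) (⟦⟧-cong pascal)) ⟩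
    ⟦ (suc k ℕ.+ suc n) C suc n ⟧ * (y * y ^ n) ∎
    where
    pascal : suc (k ℕ.+ n) C n ℕ.+ (k ℕ.+ suc n) C suc n ≡ (suc k ℕ.+ suc n) C suc n
    pascal = ≡.trans (≡.cong (λ m → m C n ℕ.+ (k ℕ.+ suc n) C suc n) (≡.sym (ℕₚ.+-suc k n)))
                     (nCk+nC[k+1]≡[n+1]C[k+1] (k ℕ.+ suc n) n)

  -- Read off from the binomial series for the square, whose coefficients are (n + 1) y^n.
  D-geometric : ∀ y → D (geometric y) ≋ mul (const y) (mul (geometric y) (geometric y))
  D-geometric y n = begin
    ⟦ suc n ⟧ * (y * y ^ n)                  ≈⟨ solve 3 (λ a y p → a :* (y :* p) := y :* (a :* p))
         refl ⟦ suc n ⟧ y (y ^ n) ⟩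
    y * (⟦ suc n ⟧ * y ^ n)                  ≈⟨ *-congˡ (*-congʳ (⟦⟧-cong (≡.sym 1+nCn))) ⟩
    y * (⟦ suc n C n ⟧ * y ^ n)              ≈⟨ *-congˡ (geometric-^ y 1 n) ⟨
    y * (geometric y SExp.^ 2) n
      ≈⟨ *-congˡ (S.*-congˡ {geometric y} (S.*-identityʳ (geometric y)) n) ⟩
    y * mul (geometric y) (geometric y) n    ≈⟨ const-*-at y (mul (geometric y) (geometric y)) n ⟨
    mul (const y) (mul (geometric y) (geometric y)) n ∎
    where
    1+nCn : suc n C n ≡ suc n
    1+nCn = ≡.trans (nCk≡nC[n∸k] (ℕₚ.n≤1+n n)) (≡.trans (≡.cong (suc n C_) (ℕₚ.m+n∸n≡m 1 n)) (nC1≡n (suc n)))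

  D-geometric-1 : D (geometric 1#) ≋ mul one (mul (geometric 1#) (geometric 1#))
  D-geometric-1 = S.trans (D-geometric 1#) (S.*-congʳ {mul (geometric 1#) (geometric 1#)} const-1)

  geometric-1-^ : ∀ k n → (geometric 1# SExp.^ suc k) n ≈ ⟦ (k ℕ.+ n) C n ⟧
  geometric-1-^ k n = trans (geometric-^ 1# k n) (trans (*-congˡ (1^ n)) (*-identityʳ _))

  scale-geometric-1 : ∀ x → scale x (geometric 1#) ≋ geometric x
  scale-geometric-1 x n = trans (*-congˡ (1^ n)) (*-identityʳ _)

-- The Chebyshev generating function after the substitution t = xu

module ChebyshevSeries {c ℓ} (R : CommutativeRing c ℓ) (x : CommutativeRing.Carrier R)
  (V : ℕ → CommutativeRing.Carrier R) where
  open CommutativeRing R hiding (zero)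
  open Ranges R
  open Exp semiring using (_^_; ^-homo-*; ^-cong)
  open FormalPowerSeries R
  open Differential seriesRing D D-isDerivation
  open RingProperties ring using (-‿distribʳ-*)
  open import Relation.Binary.Reasoning.Setoid setoid

  q p : Series
  q = Polynomials.coeff rawRing (1# ∷ - (x + x) ∷ 1# ∷ [])
  p = Polynomials.coeff rawRing (1# ∷ - 1# ∷ [])

  -- Substituting t = x u turns x - t into x (1 - u), so that its inverse powers
  -- become powers of B, up to powers of x.
  W B E H : Series
  W = scale x V
  B = geometric 1#
  E = geometric x
  H = mul E W

  B*p : mul B p ≋ one
  B*p zero    = trans (+-identityʳ _) (*-identityˡ 1#)
  B*p (suc n) = begin
    mul B p (suc n)            ≈⟨ geometric-*-suc 1# p n ⟩
    p (suc n) + 1# * mul B p n ≈⟨ +-congˡ (trans (*-identityˡ _) (B*p n)) ⟩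
    p (suc n) + one n          ≈⟨ cancel n ⟩
    0#                         ∎
    where
    cancel : ∀ n → p (suc n) + one n ≈ 0#
    cancel zero    = -‿inverseˡ 1#
    cancel (suc n) = +-identityʳ 0#

  x² : Carrier
  x² = ⟦ 2 ⟧ * (x * x)

  -- The series q(xu) = 1 - 2x^2 u + x^2 u^2 has derivative -2x^2 (1 - u), and `B` removes 1 - u.
  -- Here the substitution pays off: x - t has no inverse in ℚ[x][[t]], while 1 - u has one. The
  -- constant `x²` includes the factor 2.
  B*Dq : ∀ n → mul B (D (scale x q)) n + const x² n ≈ 0#
  B*Dq n = trans (+-congʳ (value n)) (cancel n)
    where
    d : Series
    d = D (scale x q)
    value : ∀ n → mul B d n ≈ const (- x²) n
    value zero = begin
      1# * (⟦ 1 ⟧ * (x * 1# * - (x + x))) + 0#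
        ≈⟨ solve 2 (λ x y → con 1 :* ((con 1 :+ con 0) :* (x :* con 1 :* y)) :+ con 0 := x :* y)
             refl x (- (x + x)) ⟩
      x * - (x + x)
        ≈⟨ -‿distribʳ-* x (x + x) ⟨
      - (x * (x + x))
        ≈⟨ -‿cong (solve 1 (λ x → x :* (x :+ x) := (con 1 :+ (con 1 :+ con 0)) :* (x :* x)) refl x) ⟩
      - x² ∎
    value (suc n) = trans (geometric-*-suc 1# d n) (begin
      d (suc n) + 1# * mul B d n       ≈⟨ +-congˡ (trans (*-identityˡ _) (value n)) ⟩
      d (suc n) + const (- x²) n       ≈⟨ d-cancel n ⟩
      0#                               ∎)
      where
      d-cancel : ∀ n → d (suc n) + const (- x²) n ≈ 0#
      d-cancel zero    = trans (+-congʳ (solve 2 (λ t x → t :* (x :* (x :* con 1) :* con 1) := t :* (x :* x))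
           refl ⟦ 2 ⟧ x)) (-‿inverseʳ x²)
      d-cancel (suc n) = trans (+-identityʳ _) (trans (*-congˡ (zeroʳ _)) (zeroʳ _))
    cancel : ∀ n → const (- x²) n + const x² n ≈ 0#
    cancel zero    = -‿inverseˡ x²
    cancel (suc n) = +-identityʳ 0#

  const-x² : const x² ≋ mul SRanges.⟦ 2 ⟧ (mul (const x) (const x))
  const-x² = S.trans (const-* ⟦ 2 ⟧ (x * x)) (mul-cong {const ⟦ 2 ⟧} (const-⟦⟧ 2) (const-* x x))

  module _ (generating : mul q V ≋ p) where

    -- Hence `H` is G(xu): before the substitution, q (B V) = B p = 1.
    scale-q*H : mul (scale x q) H ≋ one
    scale-q*H n = begin
      mul (scale x q) (mul E W) n
        ≈⟨ S.*-congˡ {scale x q} (mul-cong {E} {_} {W} (S.sym (scale-geometric-1 x)) S.refl) n ⟩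
      mul (scale x q) (mul (scale x B) W) n ≈⟨ S.*-congˡ {scale x q} (S.sym (scale-mul x B V)) n ⟩
      mul (scale x q) (scale x (mul B V)) n ≈⟨ scale-mul x q (mul B V) n ⟨
      x ^ n * mul q (mul B V) n
        ≈⟨ *-congˡ (SRanges.solve 3 (λ q b v → q SRanges.:* (b SRanges.:* v) SRanges.:= b SRanges.:* (q SRanges.:* v))
           S.refl q B V n) ⟩
      x ^ n * mul B (mul q V) n             ≈⟨ *-congˡ (S.*-congˡ {B} generating n) ⟩
      x ^ n * mul B p n                     ≈⟨ *-congˡ (B*p n) ⟩
      x ^ n * one n                         ≈⟨ scale-one x n ⟩
      one n                                 ∎

    B*DH : mul B (D H) ≋ mul (mul SRanges.⟦ 2 ⟧ (mul (const x) (const x))) (mul H H)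
    B*DH = S.trans (D-inverse {scale x q} {H} {B} {const x²} scale-q*H B*Dq) (S.*-congʳ {mul H H} const-x²)

    -- `H` comes from V / (1 - t) by substitution, so its power comes from the power of `V` times a
    -- binomial series. For k = N the sum is the left-hand side of the theorem.
    H-^-at : ∀ k n → (H SExp.^ suc k) n ≈
             x ^ n * sumTo (suc n) (λ l → (V SExp.^ suc k) l * ⟦ (k ℕ.+ (n ∸ l)) C (n ∸ l) ⟧)
    H-^-at k n = begin
      (mul E W SExp.^ suc k) n                        ≈⟨ SExp.^-congˡ (suc k) E*W n ⟩
      (scale x (mul V B) SExp.^ suc k) n              ≈⟨ scale-^ x (mul V B) (suc k) n ⟨
      x ^ n * (mul V B SExp.^ suc k) n                ≈⟨ *-congˡ (SExp.^-distrib-* V B (suc k) n) ⟩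
      x ^ n * mul (V SExp.^ suc k) (B SExp.^ suc k) n
        ≈⟨ *-congˡ (mul-cong {V SExp.^ suc k} S.refl (geometric-1-^ k) n) ⟩
      x ^ n * mul (V SExp.^ suc k) (λ m → ⟦ (k ℕ.+ m) C m ⟧) n ∎
      where
      E*W : mul E W ≋ scale x (mul V B)
      E*W = S.trans (mul-cong {E} {_} {W} (S.sym (scale-geometric-1 x)) S.refl)
                    (S.trans (S.sym (scale-mul x B V)) (λ n → *-congˡ (mul-comm B V n)))

    module _ (n k : ℕ) where

      -- With N = n + 1, i = j + 1 and p = k - m - s, this is the innermost term of the theorem
      -- multiplied by x^(2N+k); indeed (i - 2N - m) + (2N + k) = i + (k - m).
      summand : (j l m s : ℕ) → Carrier
      summand j l m s = ⟦ (2 ℕ.* n ∸ j ℕ.+ m) C m ⟧ * ⟦ (suc j ∸ l ℕ.+ s) C s ⟧ * ⟦ risingFactorial (k ∸ m ∸ s) l ⟧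
                        * (x ^ (suc j ℕ.+ (k ∸ m)) * V (k ∸ m ∸ s ℕ.+ l))

      -- A triple product expands over m + s + p = k. The powers of x are i - l from the Leibniz
      -- rule, s from `E` and p + l from the substituted `V`; their total i + s + p depends only on
      -- i and m.
      convolution-at : ∀ j l → l ≤ suc j →
        x ^ (suc j ∸ l) * mul (B SExp.^ suc (2 ℕ.* n ∸ j)) (mul (E SExp.^ suc (suc j ∸ l)) (D^ l W)) k ≈
        sumTo (suc k) (λ m → sumTo (suc (k ∸ m)) (summand j l m))
      convolution-at j l l≤i = begin
        x ^ d * mul b (mul e w) k
          ≈⟨ sumTo-* (suc k) (x ^ d) (λ m → b m * mul e w (k ∸ m)) ⟩
        sumTo (suc k) (λ m → x ^ d * (b m * mul e w (k ∸ m)))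
          ≈⟨ sumTo-cong (suc k) (λ m _ → trans (sym (*-assoc _ _ _)) (sumTo-* (suc (k ∸ m)) (x ^ d * b m) (λ s → e s * w (k ∸ m ∸ s)))) ⟩
        sumTo (suc k) (λ m → sumTo (suc (k ∸ m)) (λ s → x ^ d * b m * (e s * w (k ∸ m ∸ s))))
          ≈⟨ sumTo-cong (suc k) (λ m _ → sumTo-cong (suc (k ∸ m)) (at m)) ⟩
        sumTo (suc k) (λ m → sumTo (suc (k ∸ m)) (summand j l m)) ∎
        where
        d = suc j ∸ l
        b e w : Series
        b = B SExp.^ suc (2 ℕ.* n ∸ j)
        e = E SExp.^ suc d
        w = D^ l W
        at : ∀ m s → s < suc (k ∸ m) → x ^ d * b m * (e s * w (k ∸ m ∸ s)) ≈ summand j l m s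
        at m s (s≤s s≤k-m) = begin
          x ^ d * b m * (e s * w r)
            ≈⟨ *-cong (*-congˡ (geometric-1-^ (2 ℕ.* n ∸ j) m)) (*-cong (geometric-^ x d s) (D^-at l W r)) ⟩
          x ^ d * β * (γ * x ^ s * (ρ * (x ^ (r ℕ.+ l) * v)))
            ≈⟨ solve 7 (λ y b c z r u v → y :* b :* (c :* z :* (r :* (u :* v)))
                    := b :* c :* r :* (y :* (z :* u) :* v))
                 refl (x ^ d) β γ (x ^ s) ρ (x ^ (r ℕ.+ l)) v ⟩
          β * γ * ρ * (x ^ d * (x ^ s * x ^ (r ℕ.+ l)) * v)
            ≈⟨ *-congˡ (*-congʳ (trans (*-congˡ (sym (^-homo-* x s (r ℕ.+ l)))) (trans (sym (^-homo-* x d (s ℕ.+ (r ℕ.+ l)))) (^-cong refl exponents)))) ⟩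
          β * γ * ρ * (x ^ (suc j ℕ.+ (k ∸ m)) * v) ∎
          where
          r = k ∸ m ∸ s
          β = ⟦ (2 ℕ.* n ∸ j ℕ.+ m) C m ⟧
          γ = ⟦ (suc j ∸ l ℕ.+ s) C s ⟧
          ρ = ⟦ risingFactorial r l ⟧
          v = V (r ℕ.+ l)
          exponents : d ℕ.+ (s ℕ.+ (r ℕ.+ l)) ≡ suc j ℕ.+ (k ∸ m)
          exponents = ≡.trans (ℕ-rearrange d s r l) (≡.cong₂ ℕ._+_ (ℕₚ.m∸n+n≡m l≤i) (ℕₚ.m+[n∸m]≡n s≤k-m))

      D^-H-at : ∀ j → mul (B SExp.^ suc (2 ℕ.* n ∸ j)) (D^ (suc j) H) k ≈
        sumTo (suc (suc j)) (λ l → ⟦ quotient-! l (suc j ∸ l) ⟧ * sumTo (suc k) (λ m → sumTo (suc (k ∸ m)) (summand j l m)))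
      D^-H-at j = begin
        mul b (D^ (suc j) H) k
          ≈⟨ S.*-congˡ {b} (leibniz {const x} {E} {W} (D-const x) (D-geometric x) (suc j)) k ⟩
        mul b (SRanges.sumTo (suc (suc j)) term) k
          ≈⟨ SRanges.sumTo-* (suc (suc j)) b term k ⟩
        SRanges.sumTo (suc (suc j)) (λ l → mul b (term l)) k
          ≈⟨ sumTo-at (suc (suc j)) (λ l → mul b (term l)) k ⟩
        sumTo (suc (suc j)) (λ l → mul b (term l) k)
          ≈⟨ sumTo-cong (suc (suc j)) at ⟩
        sumTo (suc (suc j)) (λ l → ⟦ quotient-! l (suc j ∸ l) ⟧ * sumTo (suc k) (λ m → sumTo (suc (k ∸ m)) (summand j l m))) ∎
        where
        b : Series
        b = B SExp.^ suc (2 ℕ.* n ∸ j)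
        term : ℕ → Series
        term l = mul SRanges.⟦ quotient-! l (suc j ∸ l) ⟧ (mul (mul (const x SExp.^ (suc j ∸ l)) (E SExp.^ suc (suc j ∸ l))) (D^ l W))
        at : ∀ l → l < suc (suc j) → mul b (term l) k ≈
             ⟦ quotient-! l (suc j ∸ l) ⟧ * sumTo (suc k) (λ m → sumTo (suc (k ∸ m)) (summand j l m))
        at l (s≤s l≤i) = begin
          mul b (mul α (mul (mul y e) w)) k
            ≈⟨ SRanges.solve 5 (λ b a y e w → b SRanges.:* (a SRanges.:* (y SRanges.:* e SRanges.:* w)) SRanges.:= a SRanges.:* (y SRanges.:* (b SRanges.:* (e SRanges.:* w))))
                 S.refl b α y e w k ⟩
          mul α (mul y (mul b (mul e w))) k
            ≈⟨ ⟦⟧-*-at (quotient-! l d) (mul y (mul b (mul e w))) k ⟩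
          ⟦ quotient-! l d ⟧ * mul y (mul b (mul e w)) k
            ≈⟨ *-congˡ (const-^-*-at x d (mul b (mul e w)) k) ⟩
          ⟦ quotient-! l d ⟧ * (x ^ d * mul b (mul e w) k)
            ≈⟨ *-congˡ (convolution-at j l l≤i) ⟩
          ⟦ quotient-! l d ⟧ * sumTo (suc k) (λ m → sumTo (suc (k ∸ m)) (summand j l m)) ∎
          where
          d = suc j ∸ l
          α y e w : Series
          α = SRanges.⟦ quotient-! l d ⟧
          y = const x SExp.^ d
          e = E SExp.^ suc d
          w = D^ l W

      -- `power-expansion` in degree k: the theorem multiplied by 2^N N! x^(2N+k), so that no
      -- division is left.
      coefficient-identity :
        ⟦ 2 ℕ.^ suc n ℕ.* suc n ! ⟧ * (x ^ (2 ℕ.* suc n) * (x ^ k *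
          sumTo (suc k) (λ l → (V SExp.^ suc (suc n)) l * ⟦ (suc n ℕ.+ (k ∸ l)) C (k ∸ l) ⟧))) ≈
        sumTo (suc n) (λ j → ⟦ aℕ n j ⟧ * sumTo (suc (suc j)) (λ l →
          ⟦ quotient-! l (suc j ∸ l) ⟧ * sumTo (suc k) (λ m → sumTo (suc (k ∸ m)) (summand j l m))))
      coefficient-identity = begin
        ⟦ c₀ ⟧ * (x ^ (2 ℕ.* suc n) * (x ^ k * sumTo (suc k) (λ l → (V SExp.^ suc (suc n)) l * ⟦ (suc n ℕ.+ (k ∸ l)) C (k ∸ l) ⟧)))
          ≈⟨ *-congˡ (*-congˡ (H-^-at (suc n) k)) ⟨
        ⟦ c₀ ⟧ * (x ^ (2 ℕ.* suc n) * h k)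
          ≈⟨ *-congˡ (const-^-*-at x (2 ℕ.* suc n) h k) ⟨
        ⟦ c₀ ⟧ * mul (const x SExp.^ (2 ℕ.* suc n)) h k
          ≈⟨ ⟦⟧-*-at c₀ (mul (const x SExp.^ (2 ℕ.* suc n)) h) k ⟨
        mul SRanges.⟦ c₀ ⟧ (mul (const x SExp.^ (2 ℕ.* suc n)) h) k
          ≈⟨ power-expansion {const x} {B} {H} (D-const x) D-geometric-1 B*DH n k ⟩
        SRanges.sumTo (suc n) (λ j → mul SRanges.⟦ aℕ n j ⟧ (t j)) k
          ≈⟨ sumTo-at (suc n) (λ j → mul SRanges.⟦ aℕ n j ⟧ (t j)) k ⟩
        sumTo (suc n) (λ j → mul SRanges.⟦ aℕ n j ⟧ (t j) k)
          ≈⟨ sumTo-cong (suc n) (λ j _ → trans (⟦⟧-*-at (aℕ n j) (t j) k) (*-congˡ (D^-H-at j))) ⟩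
        sumTo (suc n) (λ j → ⟦ aℕ n j ⟧ * sumTo (suc (suc j)) (λ l →
          ⟦ quotient-! l (suc j ∸ l) ⟧ * sumTo (suc k) (λ m → sumTo (suc (k ∸ m)) (summand j l m)))) ∎
        where
        c₀ = 2 ℕ.^ suc n ℕ.* suc n !
        h : Series
        h = H SExp.^ suc (suc n)
        t : ℕ → Series
        t j = mul (B SExp.^ suc (2 ℕ.* n ∸ j)) (D^ (suc j) H)

-- The polynomial ring ℚ[x]

module ℚ⟦x⟧ = FormalPowerSeries ℚₚ.+-*-commutativeRing

coeff-neg : ∀ p n → coeff (map (λ a → ℚ.- a) p) n ≡ ℚ.- coeff p n
coeff-neg []      n       = ≡.refl
coeff-neg (a ∷ p) zero    = ≡.refl
coeff-neg (a ∷ p) (suc n) = coeff-neg p n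

coeff-mul : ∀ p q n → coeff (p Defs.*ₚ q) n ≡ ℚ⟦x⟧.mul (coeff p) (coeff q) n
coeff-mul []      q n       = ≡.sym (ℚ⟦x⟧.mul-zeroˡ (coeff q) n)
coeff-mul (a ∷ p) q zero    = coeff-* a p q zero
coeff-mul (a ∷ p) q (suc n) = ≡.trans (coeff-* a p q (suc n)) (≡.cong (a ℚ.* coeff q (suc n) ℚ.+_) (coeff-mul p q n))

coeff-one : ∀ n → coeff (1ℚ ∷ []) n ≡ ℚ⟦x⟧.one n
coeff-one zero    = ≡.refl
coeff-one (suc n) = ≡.refl

-- The ring laws of coefficient lists are pulled back from power series over ℚ, where they are
-- already proved. Injectivity is the definition of the equality of polynomials.
coeff-isRingMonomorphism : IsRingMonomorphism ℚ[x].rawRing ℚ⟦x⟧.S.rawRing coeff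
coeff-isRingMonomorphism = record
  { isRingHomomorphism = record
    { isSemiringHomomorphism = record
      { isNearSemiringHomomorphism = record
        { +-isMonoidHomomorphism = record
          { isMagmaHomomorphism = record
            { isRelHomomorphism = record { cong = id }
            ; homo = coeff-+
            }
          ; ε-homo = λ _ → ≡.refl
          }
        ; *-homo = coeff-mul
        }
      ; 1#-homo = coeff-one
      }
    ; -‿homo = coeff-neg
    }
  ; injective = id
  }

ℚ[x]-ring : CommutativeRing _ _
ℚ[x]-ring = record
  { isCommutativeRing = RingMonomorphism.isCommutativeRing coeff-isRingMonomorphism ℚ⟦x⟧.mul-isCommutativeRing }

-- p ≈ₚ q unfolds to a function type, from which p and q cannot be inferred.
record _≋ₚ_ (p q : Poly) : Set where
  constructor coefficientwise
  field
    coefficients : p Defs.≈ₚ q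
open _≋ₚ_ public
infix 4 _≋ₚ_

id-isRingMonomorphism : IsRingMonomorphism (record { RawRing ℚ[x].rawRing ; _≈_ = _≋ₚ_ }) ℚ[x].rawRing id
id-isRingMonomorphism = record
  { isRingHomomorphism = record
    { isSemiringHomomorphism = record
      { isNearSemiringHomomorphism = record
        { +-isMonoidHomomorphism = record
          { isMagmaHomomorphism = record
            { isRelHomomorphism = record { cong = coefficients }
            ; homo = λ _ _ _ → ≡.refl
            }
          ; ε-homo = λ _ → ≡.refl
          }
        ; *-homo = λ _ _ _ → ≡.refl
        }
      ; 1#-homo = λ _ → ≡.refl
      }
    ; -‿homo = λ _ _ → ≡.refl
    }
  ; injective = coefficientwise
  }

-- Carrier and operations are those of `ℚ[x]-ring`, so sums and powers formed in either ring agree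
-- by computation; only the equality is wrapped.
ℚ[X]-ring : CommutativeRing _ _
ℚ[X]-ring = record
  { isCommutativeRing = RingMonomorphism.isCommutativeRing id-isRingMonomorphism (CommutativeRing.isCommutativeRing ℚ[x]-ring) }

-- The numbers aᵢ(N)

module ℚRanges = Ranges ℚₚ.+-*-commutativeRing
open ℚRanges using () renaming (⟦_⟧ to ℚ⟦_⟧)

-- `_/_` reduces to lowest terms, so the computation is moved to unnormalised fractions, whose
-- equality is cross-multiplication.
/-+ : ∀ m n d .{{_ : ℕ.NonZero d}} → + (m ℕ.+ n) / d ≡ + m / d ℚ.+ + n / d
/-+ m n (suc d) = ℚₚ.toℚᵘ-injective (begin
  toℚᵘ (+ (m ℕ.+ n) / suc d)                  ≈⟨ ℚₚ.toℚᵘ-fromℚᵘ (mkℚᵘ (+ (m ℕ.+ n)) d) ⟩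
  mkℚᵘ (+ (m ℕ.+ n)) d
    ≈⟨ *≡* (≡.trans (≡.cong (ℤ._* (+ suc d ℤ.* + suc d)) (ℤₚ.pos-+ m n)) (common (+ m) (+ n) (+ suc d))) ⟩
  mkℚᵘ (+ m) d ℚᵘ.+ mkℚᵘ (+ n) d
    ≈⟨ ℚᵘₚ.+-cong (ℚₚ.toℚᵘ-fromℚᵘ (mkℚᵘ (+ m) d)) (ℚₚ.toℚᵘ-fromℚᵘ (mkℚᵘ (+ n) d)) ⟨
  toℚᵘ (+ m / suc d) ℚᵘ.+ toℚᵘ (+ n / suc d)  ≈⟨ ℚₚ.toℚᵘ-homo-+ (+ m / suc d) (+ n / suc d) ⟨
  toℚᵘ (+ m / suc d ℚ.+ + n / suc d)          ∎)
  where
  open ℚᵘₚ.≃-Reasoning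
  common : ∀ m n d → (m ℤ.+ n) ℤ.* (d ℤ.* d) ≡ (m ℤ.* d ℤ.+ n ℤ.* d) ℤ.* d
  common = ℤ-solve-∀

/-* : ∀ a b .{{_ : ℕ.NonZero b}} → (+ a / b) ℚ.* (+ b / 1) ≡ + a / 1
/-* a (suc b) = ℚₚ.toℚᵘ-injective (begin
  toℚᵘ ((+ a / suc b) ℚ.* (+ suc b / 1))      ≈⟨ ℚₚ.toℚᵘ-homo-* (+ a / suc b) (+ suc b / 1) ⟩
  toℚᵘ (+ a / suc b) ℚᵘ.* toℚᵘ (+ suc b / 1)
    ≈⟨ ℚᵘₚ.*-cong (ℚₚ.toℚᵘ-fromℚᵘ (mkℚᵘ (+ a) b)) (ℚₚ.toℚᵘ-fromℚᵘ (mkℚᵘ (+ suc b) 0)) ⟩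
  mkℚᵘ (+ a) b ℚᵘ.* mkℚᵘ (+ suc b) 0          ≈⟨ *≡* (assoc (+ a) (+ suc b)) ⟩
  mkℚᵘ (+ a) 0                                ≈⟨ ℚₚ.toℚᵘ-fromℚᵘ (mkℚᵘ (+ a) 0) ⟨
  toℚᵘ (+ a / 1)                              ∎)
  where
  open ℚᵘₚ.≃-Reasoning
  assoc : ∀ a b → a ℤ.* b ℤ.* + 1 ≡ a ℤ.* (b ℤ.* + 1)
  assoc = ℤ-solve-∀

/1 : ∀ n → + n / 1 ≡ ℚ⟦ n ⟧
/1 zero    = ≡.refl
/1 (suc n) = ≡.trans (/-+ 1 n 1) (≡.cong (1ℚ ℚ.+_) (/1 n))

/1-* : ∀ m n → + (m ℕ.* n) / 1 ≡ (+ m / 1) ℚ.* (+ n / 1)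
/1-* m n = ≡.trans (/1 (m ℕ.* n)) (≡.trans (ℚRanges.⟦⟧-* m n) (≡.sym (≡.cong₂ ℚ._*_ (/1 m) (/1 n))))

/-multiple : ∀ a b .{{_ : ℕ.NonZero b}} → + (a ℕ.* b) / b ≡ + a / 1
/-multiple a (suc b) = ℚₚ.fromℚᵘ-cong {mkℚᵘ (+ (a ℕ.* suc b)) b} {mkℚᵘ (+ a) 0}
  (*≡* (≡.trans (ℤₚ.*-identityʳ _) (ℤₚ.pos-* a (suc b))))

quotient-!-* : ∀ l d → quotient-! l d ℕ.* l ! ≡ (l ℕ.+ d) !
quotient-!-* l zero    = ≡.trans (ℕₚ.+-identityʳ _) (≡.cong _! (≡.sym (ℕₚ.+-identityʳ l)))
quotient-!-* l (suc d) = begin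
  (l ℕ.+ suc d) ℕ.* quotient-! l d ℕ.* l !     ≡⟨ ℕₚ.*-assoc (l ℕ.+ suc d) (quotient-! l d) (l !) ⟩
  (l ℕ.+ suc d) ℕ.* (quotient-! l d ℕ.* l !)   ≡⟨ ≡.cong₂ ℕ._*_ (ℕₚ.+-suc l d) (quotient-!-* l d) ⟩
  suc (l ℕ.+ d) !                              ≡⟨ ≡.cong _! (ℕₚ.+-suc l d) ⟨
  (l ℕ.+ suc d) !                              ∎
  where open ≡.≡-Reasoning

!/!-quotient : ∀ {i l} → l ≤ i → i !/ l ! ≡ ℚ⟦ quotient-! l (i ∸ l) ⟧
!/!-quotient {i} {l} l≤i = begin
  + (i !) / (l !)
    ≡⟨ ≡.cong (λ n → + n / (l !)) (≡.trans (quotient-!-* l (i ∸ l)) (≡.cong _! (ℕₚ.m+[n∸m]≡n l≤i))) ⟨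
  + (quotient-! l (i ∸ l) ℕ.* l !) / (l !)   ≡⟨ /-multiple (quotient-! l (i ∸ l)) (l !) ⟩
  + quotient-! l (i ∸ l) / 1                 ≡⟨ /1 (quotient-! l (i ∸ l)) ⟩
  ℚ⟦ quotient-! l (i ∸ l) ⟧                   ∎
  where
  open ≡.≡-Reasoning
  instance _ = l ℕₚ.!≢0

1/-*-⟦⟧ : ∀ n m → 1/2^ n * m ! ℚ.* ℚ⟦ 2 ℕ.^ n ℕ.* m ! ⟧ ≡ 1ℚ
1/-*-⟦⟧ n m = ≡.trans (≡.cong (1/2^ n * m ! ℚ.*_) (≡.sym (/1 (2 ℕ.^ n ℕ.* m !)))) (/-* 1 (2 ℕ.^ n ℕ.* m !))
  where instance _ = ℕₚ.m*n≢0 (2 ℕ.^ n) (m !) {{ℕₚ.m^n≢0 2 n}} {{m ℕₚ.!≢0}}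

-- The definition splits off the last factor. The recurrence for the nested sums raises base and
-- length together, which requires splitting off the first.
fallingFactorial-suc : ∀ y n → fallingFactorial (1ℚ ℚ.+ y) (suc n) ≡ (1ℚ ℚ.+ y) ℚ.* fallingFactorial y n
fallingFactorial-suc y zero    = solve 1 (λ y → con 1ℚ :* (con 1ℚ :+ y :- con 0ℚ) := (con 1ℚ :+ y) :* con 1ℚ)
     ≡.refl y
  where open +-*-Solver using (solve; _:=_; _:+_; _:*_; _:-_; con)
fallingFactorial-suc y (suc n) = begin
  fallingFactorial (1ℚ ℚ.+ y) (suc n) ℚ.* (1ℚ ℚ.+ y ℚ.- + suc n / 1)
    ≡⟨ ≡.cong₂ (λ u v → u ℚ.* (1ℚ ℚ.+ y ℚ.- v)) (fallingFactorial-suc y n) (/-+ 1 n 1) ⟩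
  (1ℚ ℚ.+ y) ℚ.* fallingFactorial y n ℚ.* (1ℚ ℚ.+ y ℚ.- (1ℚ ℚ.+ + n / 1))
    ≡⟨ solve 3 (λ y f n → (con 1ℚ :+ y) :* f :* (con 1ℚ :+ y :- (con 1ℚ :+ n))
            := (con 1ℚ :+ y) :* (f :* (y :- n)))
         ≡.refl y (fallingFactorial y n) (+ n / 1) ⟩
  (1ℚ ℚ.+ y) ℚ.* fallingFactorial y (suc n) ∎
  where
  open ≡.≡-Reasoning
  open +-*-Solver using (solve; _:=_; _:+_; _:*_; _:-_; con)

fallingFactorial-rising : ∀ p l → fallingFactorial (+ (p ℕ.+ l) / 1) l ≡ ℚ⟦ risingFactorial p l ⟧
fallingFactorial-rising p zero    = ≡.refl
fallingFactorial-rising p (suc l) = begin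
  fallingFactorial (+ (p ℕ.+ suc l) / 1) l ℚ.* (+ (p ℕ.+ suc l) / 1 ℚ.- + l / 1)
    ≡⟨ ≡.cong (λ m → fallingFactorial (+ m / 1) l ℚ.* (+ m / 1 ℚ.- + l / 1)) (ℕₚ.+-suc p l) ⟩
  fallingFactorial (+ (suc p ℕ.+ l) / 1) l ℚ.* (+ (suc p ℕ.+ l) / 1 ℚ.- + l / 1)
    ≡⟨ ≡.cong₂ (λ u v → u ℚ.* (v ℚ.- + l / 1)) (fallingFactorial-rising (suc p) l) (/-+ (suc p) l 1) ⟩
  ℚ⟦ risingFactorial (suc p) l ⟧ ℚ.* (+ suc p / 1 ℚ.+ + l / 1 ℚ.- + l / 1)
    ≡⟨ solve 3 (λ r p l → r :* (p :+ l :- l) := p :* r)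
         ≡.refl ℚ⟦ risingFactorial (suc p) l ⟧ (+ suc p / 1) (+ l / 1) ⟩
  + suc p / 1 ℚ.* ℚ⟦ risingFactorial (suc p) l ⟧
    ≡⟨ ≡.cong (ℚ._* ℚ⟦ risingFactorial (suc p) l ⟧) (/1 (suc p)) ⟩
  ℚ⟦ suc p ⟧ ℚ.* ℚ⟦ risingFactorial (suc p) l ⟧
    ≡⟨ ℚRanges.⟦⟧-* (suc p) (risingFactorial (suc p) l) ⟨
  ℚ⟦ risingFactorial p (suc l) ⟧ ∎
  where
  open ≡.≡-Reasoning
  open +-*-Solver using (solve; _:=_; _:+_; _:*_; _:-_; con)

module _ {c ℓ} (M : Monoid c ℓ) where
  open Monoid M
  open MonoidSum M using (sum-cong-≋)

  bigOp-cong : ∀ a b {f g} → (∀ k → a ≤ k → k ≤ b → f k ≈ g k) → bigOp rawMonoid a b f ≈ bigOp rawMonoid a b g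
  bigOp-cong a b f≈g = sum-cong-≋ (λ k → f≈g (a ℕ.+ toℕ k) (ℕₚ.m≤m+n a (toℕ k)) (bound k))
    where
    bound : ∀ k → a ℕ.+ toℕ k ≤ b
    bound k = ℕₚ.≤-pred (≡.subst (ℕ._≤ suc b) (≡.cong suc (ℕₚ.+-comm (toℕ k) a)) (ℕₚ.m≤o∸n⇒m+n≤o (suc (toℕ k)) a≤1+b (toℕ<n k)))
      where
      -- An index `k` exists, so the length `suc b ∸ a` is nonzero and the subtraction is exact.
      a≤1+b : a ≤ suc b
      a≤1+b = ℕₚ.<⇒≤ (ℕₚ.m∸n≢0⇒n<m (ℕₚ.m<n⇒n≢0 (toℕ<n k)))

  bigOp-last : ∀ {a b} → a ≤ suc b → ∀ f →
    bigOp rawMonoid a (suc b) f ≈ bigOp rawMonoid a b f ∙ f (suc b)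
  bigOp-last {a} {b} a≤1+b f
    rewrite ℕₚ.+-∸-assoc 1 a≤1+b =
      trans (sum-last M (suc b ∸ a) (λ k → f (a ℕ.+ k))) (∙-congˡ (reflexive (≡.cong f (ℕₚ.m+[n∸m]≡n a≤1+b))))

  bigOp-empty : ∀ a f → bigOp rawMonoid (suc a) a f ≈ ε
  bigOp-empty a f rewrite ℕₚ.n∸n≡0 a = refl

update-same : ∀ k d v → (k [ d ↦ v ]) d ≡ v
update-same k d v = ≡.cong (if_then v else k d) (dec-true (d ℕₚ.≟ d) ≡.refl)

update-other : ∀ k {d j} v → j ≢ d → (k [ d ↦ v ]) j ≡ k j
update-other k {d} {j} v j≢d = ≡.cong (if_then v else k j) (dec-false (j ℕₚ.≟ d) j≢d)

nested-∑-cong : ∀ d r {F G} → (∀ k → F k ≡ G k) → nested-∑ d r F ≡ nested-∑ d r G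
nested-∑-cong zero    r F≗G = F≗G _
nested-∑-cong (suc d) r F≗G = ℚRanges.sumTo-cong (suc r)
  (λ v _ → nested-∑-cong d (r ∸ v) (λ k → F≗G (k [ suc d ↦ v ])))

nested-∑-* : ∀ d r c F → nested-∑ d r (λ k → c ℚ.* F k) ≡ c ℚ.* nested-∑ d r F
nested-∑-* zero    r c F = ≡.refl
nested-∑-* (suc d) r c F = ≡.trans
  (ℚRanges.sumTo-cong (suc r) (λ v _ → nested-∑-* d (r ∸ v) c (λ k → F (k [ suc d ↦ v ]))))
  (≡.sym (ℚRanges.sumTo-* (suc r) c (λ v → nested-∑ d (r ∸ v) (λ k → F (k [ suc d ↦ v ])))))

∑ℕ-update : ∀ {j} d k v → j ≤ suc d → ∑ℕ j (suc d) (k [ suc d ↦ v ]) ≡ ∑ℕ j d k ℕ.+ v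
∑ℕ-update {j} d k v j≤1+d = ≡.trans (bigOp-last ℕₚ.+-0-monoid j≤1+d (k [ suc d ↦ v ]))
  (≡.cong₂ ℕ._+_ (bigOp-cong ℕₚ.+-0-monoid j d (λ l _ l≤d → update-other k v (ℕₚ.<⇒≢ (s≤s l≤d))))
                 (update-same k (suc d) v))

-- The factors of a summand of a_{d+2}(N) that involve only its outermost index k_{d+1} = v.
outer-weight : (d N v : ℕ) → ℚ
outer-weight d N v = (+ (2 ℕ.^ v) / 1) ℚ.* fallingFactorial (+ N / 1 ℚ.- + (4 ℕ.+ d) / 2) v

module _ (d v M : ℕ) (k : ℕ → ℕ) where
  private
    k′ : ℕ → ℕ
    k′ = k [ suc d ↦ v ]
    N = suc (v ℕ.+ M)

    factor : ℕ → ℕ → (ℕ → ℕ) → ℕ → ℚ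
    factor i N k j = fallingFactorial ((+ N / 1) ℚ.- (+ ∑ℕ j (i ∸ 1) k / 1) ℚ.- (+ (2 ℕ.* i ℕ.+ 2 ∸ j) / 2)) (k (j ∸ 1))

    -- As N = 1 + v + M, the `v` added to the index sum cancels, and raising i by one raises (2i + 2
    -- - j)/2 by the remaining 1.
    factor-shift : ∀ j → 2 ≤ j → j ≤ suc d → factor (suc (suc d)) N k′ j ≡ factor (suc d) M k j
    factor-shift j (s≤s (s≤s _)) j≤1+d@(s≤s j-1≤d) = ≡.cong₂ fallingFactorial base (update-other k v (ℕₚ.<⇒≢ (s≤s j-1≤d)))
      where
      open ≡.≡-Reasoning
      open +-*-Solver using (solve; _:=_; _:+_; _:*_; _:-_; con)
      A = ∑ℕ j d k
      b = 2 ℕ.* suc d ℕ.+ 2 ∸ j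
      half : 2 ℕ.* suc (suc d) ℕ.+ 2 ∸ j ≡ 2 ℕ.+ b
      half = ≡.trans (≡.cong (λ m → m ℕ.+ 2 ∸ j) (ℕₚ.*-suc 2 (suc d)))
                     (ℕₚ.+-∸-assoc 2 (ℕₚ.≤-trans j≤1+d (ℕₚ.≤-trans (ℕₚ.m≤n*m (suc d) 2) (ℕₚ.m≤m+n _ 2))))
      base : + N / 1 ℚ.- + ∑ℕ j (suc d) k′ / 1 ℚ.- + (2 ℕ.* suc (suc d) ℕ.+ 2 ∸ j) / 2 ≡ + M / 1 ℚ.- + A / 1 ℚ.- + b / 2
      base = begin
        + N / 1 ℚ.- + ∑ℕ j (suc d) k′ / 1 ℚ.- + (2 ℕ.* suc (suc d) ℕ.+ 2 ∸ j) / 2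
          ≡⟨ ≡.cong₂ (λ s t → + N / 1 ℚ.- + s / 1 ℚ.- + t / 2) (∑ℕ-update d k v j≤1+d) half ⟩
        + N / 1 ℚ.- + (A ℕ.+ v) / 1 ℚ.- + (2 ℕ.+ b) / 2
          ≡⟨ ≡.cong₂ (λ s t → s ℚ.- + (A ℕ.+ v) / 1 ℚ.- t) (≡.trans (/-+ 1 (v ℕ.+ M) 1) (≡.cong (1ℚ ℚ.+_) (/-+ v M 1))) (/-+ 2 b 2) ⟩
        1ℚ ℚ.+ (+ v / 1 ℚ.+ + M / 1) ℚ.- + (A ℕ.+ v) / 1 ℚ.- (1ℚ ℚ.+ + b / 2)
          ≡⟨ ≡.cong (λ s → 1ℚ ℚ.+ (+ v / 1 ℚ.+ + M / 1) ℚ.- s ℚ.- (1ℚ ℚ.+ + b / 2)) (/-+ A v 1) ⟩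
        1ℚ ℚ.+ (+ v / 1 ℚ.+ + M / 1) ℚ.- (+ A / 1 ℚ.+ + v / 1) ℚ.- (1ℚ ℚ.+ + b / 2)
          ≡⟨ solve 4 (λ v M A b → con 1ℚ :+ (v :+ M) :- (A :+ v) :- (con 1ℚ :+ b) := M :- A :- b)
               ≡.refl (+ v / 1) (+ M / 1) (+ A / 1) (+ b / 2) ⟩
        + M / 1 ℚ.- + A / 1 ℚ.- + b / 2 ∎

    -- For j = i = d + 2 the inner index sum is empty and 2i + 2 - j = d + 4.
    factor-last : factor (suc (suc d)) N k′ (suc (suc d)) ≡ fallingFactorial (+ N / 1 ℚ.- + (4 ℕ.+ d) / 2) v
    factor-last = ≡.cong₂ fallingFactorial
      (≡.trans (≡.cong₂ (λ s t → + N / 1 ℚ.- + s / 1 ℚ.- + t / 2) (bigOp-empty ℕₚ.+-0-monoid (suc d) k′) half)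
               (≡.cong (ℚ._- + (4 ℕ.+ d) / 2) (ℚₚ.+-identityʳ (+ N / 1))))
      (update-same k (suc d) v)
      where
      half : 2 ℕ.* suc (suc d) ℕ.+ 2 ∸ suc (suc d) ≡ 4 ℕ.+ d
      half = ≡.trans (≡.cong (_∸ suc (suc d)) (regroup d)) (ℕₚ.m+n∸m≡n (suc (suc d)) (4 ℕ.+ d))
        where
        regroup : ∀ d → 2 ℕ.* suc (suc d) ℕ.+ 2 ≡ suc (suc d) ℕ.+ (4 ℕ.+ d)
        regroup = ℕ-solve-∀

  -- Fixing the outermost index replaces i by i - 1 and N by M = N - 1 - v. The double factorial is
  -- unaffected because N - i - v = M - (i - 1).
  a-summand-outer : a-summand (suc (suc d)) N k′ ≡ outer-weight d N v ℚ.* a-summand (suc d) M k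
  a-summand-outer = begin
    (+ (2 ℕ.^ ∑ℕ 1 (suc d) k′) / 1) ℚ.* ∏ℚ 2 (suc (suc d)) (factor (suc (suc d)) N k′)
      ℚ.* (+ [2 (N ∸ suc (suc d) ∸ ∑ℕ 1 (suc d) k′) -1]!! / 1)
      ≡⟨ ≡.cong₂ (λ s t → s ℚ.* ∏ℚ 2 (suc (suc d)) (factor (suc (suc d)) N k′) ℚ.* (+ [2 t -1]!! / 1)) powers index ⟩
    (+ (2 ℕ.^ S) / 1) ℚ.* (+ (2 ℕ.^ v) / 1) ℚ.* ∏ℚ 2 (suc (suc d)) (factor (suc (suc d)) N k′) ℚ.* odd
      ≡⟨ ≡.cong (λ t → (+ (2 ℕ.^ S) / 1) ℚ.* (+ (2 ℕ.^ v) / 1) ℚ.* t ℚ.* odd) products ⟩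
    (+ (2 ℕ.^ S) / 1) ℚ.* (+ (2 ℕ.^ v) / 1) ℚ.* (∏ℚ 2 (suc d) (factor (suc d) M k) ℚ.* fallingFactorial (+ N / 1 ℚ.- + (4 ℕ.+ d) / 2) v) ℚ.* odd
      ≡⟨ solve 5 (λ s v p f o → s :* v :* (p :* f) :* o := v :* f :* (s :* p :* o)) ≡.refl
           (+ (2 ℕ.^ S) / 1) (+ (2 ℕ.^ v) / 1) (∏ℚ 2 (suc d) (factor (suc d) M k)) (fallingFactorial (+ N / 1 ℚ.- + (4 ℕ.+ d) / 2) v) odd ⟩
    outer-weight d N v ℚ.* a-summand (suc d) M k ∎
    where
    open ≡.≡-Reasoning
    open +-*-Solver using (solve; _:=_; _:+_; _:*_; _:-_; con)
    S = ∑ℕ 1 d k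
    odd = + [2 (M ∸ suc d ∸ S) -1]!! / 1
    powers : + (2 ℕ.^ ∑ℕ 1 (suc d) k′) / 1 ≡ (+ (2 ℕ.^ S) / 1) ℚ.* (+ (2 ℕ.^ v) / 1)
    powers = begin
      + (2 ℕ.^ ∑ℕ 1 (suc d) k′) / 1          ≡⟨ ≡.cong (λ s → + (2 ℕ.^ s) / 1) (∑ℕ-update d k v (s≤s z≤n)) ⟩
      + (2 ℕ.^ (S ℕ.+ v)) / 1                ≡⟨ ≡.cong (λ s → + s / 1) (ℕₚ.^-distribˡ-+-* 2 S v) ⟩
      + (2 ℕ.^ S ℕ.* 2 ℕ.^ v) / 1            ≡⟨ /1-* (2 ℕ.^ S) (2 ℕ.^ v) ⟩
      (+ (2 ℕ.^ S) / 1) ℚ.* (+ (2 ℕ.^ v) / 1) ∎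
    index : N ∸ suc (suc d) ∸ ∑ℕ 1 (suc d) k′ ≡ M ∸ suc d ∸ S
    index = begin
      v ℕ.+ M ∸ suc d ∸ ∑ℕ 1 (suc d) k′    ≡⟨ ≡.cong (v ℕ.+ M ∸ suc d ∸_) (∑ℕ-update d k v (s≤s z≤n)) ⟩
      v ℕ.+ M ∸ suc d ∸ (S ℕ.+ v)          ≡⟨ ℕₚ.∸-+-assoc (v ℕ.+ M) (suc d) (S ℕ.+ v) ⟩
      v ℕ.+ M ∸ (suc d ℕ.+ (S ℕ.+ v))      ≡⟨ ≡.cong (v ℕ.+ M ∸_) (rotate d S v) ⟩
      v ℕ.+ M ∸ (v ℕ.+ (suc d ℕ.+ S))      ≡⟨ ℕₚ.[m+n]∸[m+o]≡n∸o v M (suc d ℕ.+ S) ⟩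
      M ∸ (suc d ℕ.+ S)                    ≡⟨ ℕₚ.∸-+-assoc M (suc d) S ⟨
      M ∸ suc d ∸ S                        ∎
      where
      rotate : ∀ d S v → suc d ℕ.+ (S ℕ.+ v) ≡ v ℕ.+ (suc d ℕ.+ S)
      rotate = ℕ-solve-∀
    products : ∏ℚ 2 (suc (suc d)) (factor (suc (suc d)) N k′) ≡
               ∏ℚ 2 (suc d) (factor (suc d) M k) ℚ.* fallingFactorial (+ N / 1 ℚ.- + (4 ℕ.+ d) / 2) v
    products = ≡.trans (bigOp-last ℚₚ.*-1-monoid {2} {suc d} (s≤s (s≤s z≤n)) (factor (suc (suc d)) N k′))
      (≡.cong₂ ℚ._*_ (bigOp-cong ℚₚ.*-1-monoid 2 (suc d) factor-shift) factor-last)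

-- The separate clause for i = 1 agrees with the general formula, which there has one summand and an
-- empty product; so `a-outer` applies from i = 2 on.
a-nested : ∀ d N → a (suc d) N ≡ nested-∑ d (N ∸ suc d) (a-summand (suc d) N)
a-nested zero    N = ≡.sym (ℚₚ.*-identityˡ (+ [2 (N ∸ 1) -1]!! / 1))
a-nested (suc d) N = ≡.refl

-- Writing N = i + r makes the range 0, ..., r of the outermost index explicit and turns N - 1 - v
-- into (i - 1) + (r - v), so that the subtraction is exact.
a-outer : ∀ d r → a (suc (suc d)) (suc (suc d) ℕ.+ r) ≡
  ℚRanges.sumTo (suc r) (λ v → outer-weight d (suc (suc d) ℕ.+ r) v ℚ.* a (suc d) (suc d ℕ.+ (r ∸ v)))
a-outer d r = ≡.trans (≡.cong (λ m → nested-∑ (suc d) m (a-summand (suc (suc d)) N)) (ℕₚ.m+n∸m≡n (suc (suc d)) r))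
  (ℚRanges.sumTo-cong (suc r) step)
  where
  open ≡.≡-Reasoning
  N = suc (suc d) ℕ.+ r
  step : ∀ v → v < suc r → nested-∑ d (r ∸ v) (λ k → a-summand (suc (suc d)) N (k [ suc d ↦ v ])) ≡
         outer-weight d N v ℚ.* a (suc d) (suc d ℕ.+ (r ∸ v))
  step v (s≤s v≤r) = begin
    nested-∑ d (r ∸ v) (λ k → a-summand (suc (suc d)) N (k [ suc d ↦ v ]))
      ≡⟨ nested-∑-cong d (r ∸ v) (λ k → ≡.subst (λ n → a-summand (suc (suc d)) n (k [ suc d ↦ v ]) ≡ outer-weight d n v ℚ.* a-summand (suc d) M k) N-split (a-summand-outer d v M k)) ⟩
    nested-∑ d (r ∸ v) (λ k → outer-weight d N v ℚ.* a-summand (suc d) M k)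
      ≡⟨ nested-∑-* d (r ∸ v) (outer-weight d N v) (a-summand (suc d) M) ⟩
    outer-weight d N v ℚ.* nested-∑ d (r ∸ v) (a-summand (suc d) M)
      ≡⟨ ≡.cong (λ m → outer-weight d N v ℚ.* nested-∑ d m (a-summand (suc d) M)) (ℕₚ.m+n∸m≡n (suc d) (r ∸ v)) ⟨
    outer-weight d N v ℚ.* nested-∑ d (M ∸ suc d) (a-summand (suc d) M)
      ≡⟨ ≡.cong (outer-weight d N v ℚ.*_) (a-nested d M) ⟨
    outer-weight d N v ℚ.* a (suc d) M ∎
    where
    M = suc d ℕ.+ (r ∸ v)
    N-split : suc (v ℕ.+ M) ≡ N
    N-split = ≡.trans (rotate v d (r ∸ v)) (≡.cong (suc (suc d) ℕ.+_) (ℕₚ.m+[n∸m]≡n v≤r))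
      where
      rotate : ∀ v d r → suc (v ℕ.+ (suc d ℕ.+ r)) ≡ suc (suc d) ℕ.+ (v ℕ.+ r)
      rotate = ℕ-solve-∀

-- With i = d + 2, N = i + r and y = N - (d + 4)/2, the new factor 2 (y + 1) equals 2N - i: the
-- power of 2 clears the half-integer.
outer-weight-suc : ∀ d r v → outer-weight d (suc (suc d) ℕ.+ suc r) (suc v) ≡
  ℚ⟦ 2 ℕ.* suc (d ℕ.+ r) ∸ d ⟧ ℚ.* outer-weight d (suc (suc d) ℕ.+ r) v
outer-weight-suc d r v = begin
  (+ (2 ℕ.^ suc v) / 1) ℚ.* fallingFactorial (+ (suc (suc d) ℕ.+ suc r) / 1 ℚ.- h) (suc v)
    ≡⟨ ≡.cong₂ (λ s t → s ℚ.* fallingFactorial t (suc v)) (/1-* 2 (2 ℕ.^ v)) shifted ⟩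
  2ℚ ℚ.* p ℚ.* fallingFactorial (1ℚ ℚ.+ y) (suc v)
    ≡⟨ ≡.cong (2ℚ ℚ.* p ℚ.*_) (fallingFactorial-suc y v) ⟩
  2ℚ ℚ.* p ℚ.* ((1ℚ ℚ.+ y) ℚ.* f)
    ≡⟨ solve 4 (λ t p y f → t :* p :* ((con 1ℚ :+ y) :* f) := t :* (con 1ℚ :+ y) :* (p :* f))
         ≡.refl 2ℚ p y f ⟩
  2ℚ ℚ.* (1ℚ ℚ.+ y) ℚ.* (p ℚ.* f)
    ≡⟨ ≡.cong (ℚ._* (p ℚ.* f)) doubled ⟩
  ℚ⟦ 2 ℕ.* suc (d ℕ.+ r) ∸ d ⟧ ℚ.* (p ℚ.* f) ∎
  where
  open ≡.≡-Reasoning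
  open +-*-Solver using (solve; _:=_; _:+_; _:*_; _:-_; con)
  2ℚ = + 2 / 1
  h = + (4 ℕ.+ d) / 2
  p = + (2 ℕ.^ v) / 1
  y = + (suc (suc d) ℕ.+ r) / 1 ℚ.- h
  f = fallingFactorial y v
  shifted : + (suc (suc d) ℕ.+ suc r) / 1 ℚ.- h ≡ 1ℚ ℚ.+ y
  shifted = ≡.trans (≡.cong (ℚ._- h) (≡.trans (≡.cong (λ n → + n / 1) (ℕₚ.+-suc (suc (suc d)) r)) (/-+ 1 (suc (suc d) ℕ.+ r) 1)))
                    (ℚₚ.+-assoc 1ℚ (+ (suc (suc d) ℕ.+ r) / 1) (ℚ.- h))
  e = 2 ℕ.* suc (d ℕ.+ r) ∸ d
  index : 2 ℕ.* (1 ℕ.+ (suc (suc d) ℕ.+ r)) ≡ (4 ℕ.+ d) ℕ.+ e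
  index = ≡.trans (regroup d r) (≡.cong (4 ℕ.+ d ℕ.+_) (≡.sym e-value))
    where
    regroup : ∀ d r → 2 ℕ.* (1 ℕ.+ (suc (suc d) ℕ.+ r)) ≡ (4 ℕ.+ d) ℕ.+ (2 ℕ.+ d ℕ.+ 2 ℕ.* r)
    regroup = ℕ-solve-∀
    regroup′ : ∀ d r → 2 ℕ.* suc (d ℕ.+ r) ≡ d ℕ.+ (2 ℕ.+ d ℕ.+ 2 ℕ.* r)
    regroup′ = ℕ-solve-∀
    e-value : e ≡ 2 ℕ.+ d ℕ.+ 2 ℕ.* r
    e-value = ≡.trans (≡.cong (_∸ d) (regroup′ d r)) (ℕₚ.m+n∸m≡n d _)
  doubled : 2ℚ ℚ.* (1ℚ ℚ.+ y) ≡ ℚ⟦ e ⟧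
  doubled = begin
    2ℚ ℚ.* (1ℚ ℚ.+ (n ℚ.- h))
      ≡⟨ solve 3 (λ t n h → t :* (con 1ℚ :+ (n :- h)) := t :* (con 1ℚ :+ n) :- h :* t) ≡.refl 2ℚ n h ⟩
    2ℚ ℚ.* (1ℚ ℚ.+ n) ℚ.- h ℚ.* 2ℚ
      ≡⟨ ≡.cong₂ ℚ._-_ (≡.trans (≡.cong (2ℚ ℚ.*_) (≡.sym (/-+ 1 (suc (suc d) ℕ.+ r) 1))) (≡.sym (/1-* 2 (1 ℕ.+ (suc (suc d) ℕ.+ r))))) (/-* (4 ℕ.+ d) 2) ⟩
    + (2 ℕ.* (1 ℕ.+ (suc (suc d) ℕ.+ r))) / 1 ℚ.- + (4 ℕ.+ d) / 1
      ≡⟨ ≡.cong (λ m → m ℚ.- + (4 ℕ.+ d) / 1) (≡.trans (≡.cong (λ m → + m / 1) index) (/-+ (4 ℕ.+ d) e 1)) ⟩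
    + (4 ℕ.+ d) / 1 ℚ.+ + e / 1 ℚ.- + (4 ℕ.+ d) / 1
      ≡⟨ solve 2 (λ a b → a :+ b :- a := b) ≡.refl (+ (4 ℕ.+ d) / 1) (+ e / 1) ⟩
    + e / 1
      ≡⟨ /1 e ⟩
    ℚ⟦ e ⟧ ∎
    where n = + (suc (suc d) ℕ.+ r) / 1

-- In `a-outer` for N + 1 the term v = 0 has weight 1 and is aᵢ₋₁(N); by `outer-weight-suc` the term
-- v + 1 is 2N - i times the term v for N.
a-recurrence : ∀ d r → a (suc (suc d)) (suc (suc d) ℕ.+ suc r) ≡
  ℚ⟦ 2 ℕ.* suc (d ℕ.+ r) ∸ d ⟧ ℚ.* a (suc (suc d)) (suc (suc d) ℕ.+ r) ℚ.+ a (suc d) (suc d ℕ.+ suc r)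
a-recurrence d r = begin
  a (suc (suc d)) (suc (suc d) ℕ.+ suc r)
    ≡⟨ a-outer d (suc r) ⟩
  1ℚ ℚ.* 1ℚ ℚ.* b ℚ.+ ℚRanges.sumTo (suc r) (λ v → outer-weight d (suc (suc d) ℕ.+ suc r) (suc v) ℚ.* a (suc d) (suc d ℕ.+ (r ∸ v)))
    ≡⟨ ≡.cong₂ ℚ._+_ (≡.trans (≡.cong (ℚ._* b) (ℚₚ.*-identityˡ 1ℚ)) (ℚₚ.*-identityˡ b))
         (ℚRanges.sumTo-cong (suc r) (λ v _ → ≡.trans (≡.cong (ℚ._* a (suc d) (suc d ℕ.+ (r ∸ v))) (outer-weight-suc d r v)) (ℚₚ.*-assoc e _ _))) ⟩
  b ℚ.+ ℚRanges.sumTo (suc r) (λ v → e ℚ.* term v)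
    ≡⟨ ≡.cong (b ℚ.+_) (ℚRanges.sumTo-* (suc r) e term) ⟨
  b ℚ.+ e ℚ.* ℚRanges.sumTo (suc r) term
    ≡⟨ ≡.cong (λ s → b ℚ.+ e ℚ.* s) (a-outer d r) ⟨
  b ℚ.+ e ℚ.* a (suc (suc d)) (suc (suc d) ℕ.+ r)
    ≡⟨ ℚₚ.+-comm b _ ⟩
  e ℚ.* a (suc (suc d)) (suc (suc d) ℕ.+ r) ℚ.+ b ∎
  where
  open ≡.≡-Reasoning
  b = a (suc d) (suc d ℕ.+ suc r)
  e = ℚ⟦ 2 ℕ.* suc (d ℕ.+ r) ∸ d ⟧
  term : ℕ → ℚ
  term v = outer-weight d (suc (suc d) ℕ.+ r) v ℚ.* a (suc d) (suc d ℕ.+ (r ∸ v))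

aℕ-double-factorial : ∀ n → aℕ n 0 ≡ [2 n -1]!!
aℕ-double-factorial zero    = ≡.refl
aℕ-double-factorial (suc n) = ≡.cong ((2 ℕ.* n ℕ.+ 1) ℕ.*_) (aℕ-double-factorial n)

-- Induction on `j` and on the distance `r` from the diagonal. On the diagonal `a-outer` has a
-- single term, and the first summand in the recurrence of `aℕ` vanishes.
a-aℕ : ∀ j r → a (suc j) (suc j ℕ.+ r) ≡ ℚ⟦ aℕ (j ℕ.+ r) j ⟧
a-aℕ zero    r       = ≡.trans (≡.cong (λ m → + m / 1) (≡.sym (aℕ-double-factorial r))) (/1 (aℕ r 0))
a-aℕ (suc d) zero    = begin
  a (suc (suc d)) (suc (suc d) ℕ.+ 0)
    ≡⟨ a-outer d 0 ⟩
  1ℚ ℚ.* 1ℚ ℚ.* a (suc d) (suc d ℕ.+ 0) ℚ.+ 0ℚ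
    ≡⟨ ≡.trans (ℚₚ.+-identityʳ _) (≡.trans (≡.cong (ℚ._* a (suc d) (suc d ℕ.+ 0)) (ℚₚ.*-identityˡ 1ℚ)) (ℚₚ.*-identityˡ _)) ⟩
  a (suc d) (suc d ℕ.+ 0)
    ≡⟨ a-aℕ d 0 ⟩
  ℚ⟦ aℕ (d ℕ.+ 0) d ⟧
    ≡⟨ ℚRanges.⟦⟧-cong (≡.cong (ℕ._+ aℕ (d ℕ.+ 0) d) (≡.trans (≡.cong ((2 ℕ.* (d ℕ.+ 0) ∸ d) ℕ.*_) top) (ℕₚ.*-zeroʳ (2 ℕ.* (d ℕ.+ 0) ∸ d)))) ⟨
  ℚ⟦ aℕ (suc d ℕ.+ 0) (suc d) ⟧ ∎
  where
  open ≡.≡-Reasoning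
  top : aℕ (d ℕ.+ 0) (suc d) ≡ 0
  top = aℕ-zero (s≤s (ℕₚ.≤-reflexive (ℕₚ.+-identityʳ d)))
a-aℕ (suc d) (suc r) = begin
  a (suc (suc d)) (suc (suc d) ℕ.+ suc r)
    ≡⟨ a-recurrence d r ⟩
  ℚ⟦ 2 ℕ.* suc (d ℕ.+ r) ∸ d ⟧ ℚ.* a (suc (suc d)) (suc (suc d) ℕ.+ r) ℚ.+ a (suc d) (suc d ℕ.+ suc r)
    ≡⟨ ≡.cong₂ (λ s t → ℚ⟦ 2 ℕ.* suc (d ℕ.+ r) ∸ d ⟧ ℚ.* s ℚ.+ t) (a-aℕ (suc d) r) (a-aℕ d (suc r)) ⟩
  ℚ⟦ 2 ℕ.* suc (d ℕ.+ r) ∸ d ⟧ ℚ.* ℚ⟦ aℕ (suc (d ℕ.+ r)) (suc d) ⟧ ℚ.+ ℚ⟦ aℕ (d ℕ.+ suc r) d ⟧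
    ≡⟨ ≡.cong (λ m → ℚ⟦ 2 ℕ.* m ∸ d ⟧ ℚ.* ℚ⟦ aℕ m (suc d) ⟧ ℚ.+ ℚ⟦ aℕ (d ℕ.+ suc r) d ⟧) (≡.sym (ℕₚ.+-suc d r)) ⟩
  ℚ⟦ 2 ℕ.* n ∸ d ⟧ ℚ.* ℚ⟦ aℕ n (suc d) ⟧ ℚ.+ ℚ⟦ aℕ n d ⟧
    ≡⟨ ≡.cong (ℚ._+ ℚ⟦ aℕ n d ⟧) (ℚRanges.⟦⟧-* (2 ℕ.* n ∸ d) (aℕ n (suc d))) ⟨
  ℚ⟦ (2 ℕ.* n ∸ d) ℕ.* aℕ n (suc d) ⟧ ℚ.+ ℚ⟦ aℕ n d ⟧
    ≡⟨ ℚRanges.⟦⟧-+ ((2 ℕ.* n ∸ d) ℕ.* aℕ n (suc d)) (aℕ n d) ⟨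
  ℚ⟦ aℕ (suc n) (suc d) ⟧ ∎
  where
  open ≡.≡-Reasoning
  n = d ℕ.+ suc r

-- Fractions over ℚ[x]

module Fractions {c ℓ} (R : CommutativeRing c ℓ) where
  open CommutativeRing R
  open Ranges R
  open import Relation.Binary.Reasoning.Setoid setoid

  fraction-+ : ∀ {n₁ d₁ p₁ n₂ d₂ p₂ y} → n₁ * y ≈ p₁ * d₁ → n₂ * y ≈ p₂ * d₂ →
    (n₁ * d₂ + n₂ * d₁) * y ≈ (p₁ + p₂) * (d₁ * d₂)
  fraction-+ {n₁} {d₁} {p₁} {n₂} {d₂} {p₂} {y} eq₁ eq₂ = begin
    (n₁ * d₂ + n₂ * d₁) * y
      ≈⟨ solve 5 (λ n₁ d₁ n₂ d₂ y → (n₁ :* d₂ :+ n₂ :* d₁) :* y := n₁ :* y :* d₂ :+ n₂ :* y :* d₁)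
         refl n₁ d₁ n₂ d₂ y ⟩
    n₁ * y * d₂ + n₂ * y * d₁     ≈⟨ +-cong (*-congʳ eq₁) (*-congʳ eq₂) ⟩
    p₁ * d₁ * d₂ + p₂ * d₂ * d₁
      ≈⟨ solve 4 (λ p₁ d₁ p₂ d₂ → p₁ :* d₁ :* d₂ :+ p₂ :* d₂ :* d₁ := (p₁ :+ p₂) :* (d₁ :* d₂))
         refl p₁ d₁ p₂ d₂ ⟩
    (p₁ + p₂) * (d₁ * d₂)         ∎

  fraction-* : ∀ {n₁ d₁ p₁ y₁ n₂ d₂ p₂ y₂} → n₁ * y₁ ≈ p₁ * d₁ → n₂ * y₂ ≈ p₂ * d₂ →
    n₁ * n₂ * (y₁ * y₂) ≈ p₁ * p₂ * (d₁ * d₂)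
  fraction-* {n₁} {d₁} {p₁} {y₁} {n₂} {d₂} {p₂} {y₂} eq₁ eq₂ = begin
    n₁ * n₂ * (y₁ * y₂)   ≈⟨ interchange n₁ n₂ y₁ y₂ ⟩
    n₁ * y₁ * (n₂ * y₂)   ≈⟨ *-cong eq₁ eq₂ ⟩
    p₁ * d₁ * (p₂ * d₂)   ≈⟨ interchange p₁ d₁ p₂ d₂ ⟩
    p₁ * p₂ * (d₁ * d₂)   ∎
    where
    interchange : ∀ a b c d → a * b * (c * d) ≈ a * c * (b * d)
    interchange = solve 4 (λ a b c d → a :* b :* (c :* d) := a :* c :* (b :* d)) refl

  -- Two fractions equal to p / y agree up to the factor `y`, which `X-cancel` removes when `y` is a
  -- power of `X`.
  fraction-unique : ∀ {n₁ d₁ n₂ d₂ p y} → n₁ * y ≈ p * d₁ → n₂ * y ≈ p * d₂ →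
    y * (n₁ * d₂) ≈ y * (n₂ * d₁)
  fraction-unique {n₁} {d₁} {n₂} {d₂} {p} {y} eq₁ eq₂ = begin
    y * (n₁ * d₂)   ≈⟨ solve 3 (λ y n d → y :* (n :* d) := n :* y :* d) refl y n₁ d₂ ⟩
    n₁ * y * d₂     ≈⟨ *-congʳ eq₁ ⟩
    p * d₁ * d₂     ≈⟨ solve 3 (λ p d e → p :* d :* e := p :* e :* d) refl p d₁ d₂ ⟩
    p * d₂ * d₁     ≈⟨ *-congʳ eq₂ ⟨
    n₂ * y * d₁     ≈⟨ solve 3 (λ y n d → n :* y :* d := y :* (n :* d)) refl y n₂ d₁ ⟩
    y * (n₂ * d₁)   ∎

  fraction-expand : ∀ {n d p y} z → n * y ≈ p * d → n * (y * z) ≈ p * z * d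
  fraction-expand {n} {d} {p} {y} z eq = begin
    n * (y * z)  ≈⟨ *-assoc n y z ⟨
    n * y * z    ≈⟨ *-congʳ eq ⟩
    p * d * z    ≈⟨ solve 3 (λ p d z → p :* d :* z := p :* z :* d) refl p d z ⟩
    p * z * d    ∎

module ℚ[X] = CommutativeRing ℚ[X]-ring
module ℚ[X]Ranges = Ranges ℚ[X]-ring
module ℚ[x]Ranges = Ranges ℚ[x]-ring
open Exp (CommutativeRing.semiring ℚ[x]-ring) using (_^_; ^-homo-*)
open ℚ[x]Ranges using (⟦_⟧; sumTo)
open ℚ[X]Ranges using (_:=_; _:*_; con)
open Fractions ℚ[X]-ring

-- f = p / y in ℚ(x), stated without dividing and without asking y ≢ 0.
record Represents (f : RatFun) (y p : Poly) : Set where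
  constructor represents
  field
    cross-multiplied : num f *ₚ y ≋ₚ p *ₚ den f
open Represents

Represents-resp : ∀ {f y y′ p p′} → y ≋ₚ y′ → p ≋ₚ p′ → Represents f y p → Represents f y′ p′
Represents-resp {f} y≈y′ p≈p′ (represents eq) = represents
  (ℚ[X].trans (ℚ[X].*-congˡ {num f} (ℚ[X].sym y≈y′)) (ℚ[X].trans eq (ℚ[X].*-congʳ {den f} p≈p′)))

Represents-expand : ∀ {f y p} z → Represents f y p → Represents f (y *ₚ z) (p *ₚ z)
Represents-expand {f} {y} {p} z (represents eq) = represents (fraction-expand {num f} {den f} {p} {y} z eq)

Represents-⊗ : ∀ {f g y z p q} → Represents f y p → Represents g z q → Represents (f ⊗ g) (y *ₚ z) (p *ₚ q)
Represents-⊗ {f} {g} {y} {z} {p} {q} (represents eq₁) (represents eq₂) =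
  represents (fraction-* {num f} {den f} {p} {y} {num g} {den g} {q} {z} eq₁ eq₂)

Represents-fromPoly : ∀ p → Represents (fromPoly p) ℚ[X].1# p
Represents-fromPoly p = represents ℚ[X].refl

constant-zero : (0ℚ ∷ []) ≋ₚ []
constant-zero = coefficientwise λ where
  zero    → ≡.refl
  (suc _) → ≡.refl

constant-* : ∀ a b → (a ℚ.* b ∷ []) ≋ₚ (a ∷ []) *ₚ (b ∷ [])
constant-* a b = coefficientwise λ where
  zero    → ≡.sym (ℚₚ.+-identityʳ (a ℚ.* b))
  (suc _) → ≡.refl

constant-⟦⟧ : ∀ n → (ℚ⟦ n ⟧ ∷ []) ≋ₚ ⟦ n ⟧
constant-⟦⟧ zero    = constant-zero
constant-⟦⟧ (suc n) = ℚ[X].+-congˡ {1ℚ ∷ []} (constant-⟦⟧ n)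

constant-≡⟦⟧ : ∀ {a} n → a ≡ ℚ⟦ n ⟧ → (a ∷ []) ≋ₚ ⟦ n ⟧
constant-≡⟦⟧ n ≡.refl = constant-⟦⟧ n

ℚ⟨x⟩-sum : ∀ n → (ℕ → RatFun) → RatFun
ℚ⟨x⟩-sum n f = RawMonoidDefs.sum (RawRing.+-rawMonoid ℚ⟨x⟩-rawRing) {n} (λ k → f (toℕ k))

-- Over the common denominator `y` the numerators simply add, whatever product of denominators `_⊕_`
-- has accumulated in the sum itself.
Represents-sum : ∀ y n f p → (∀ k → k < n → Represents (f k) y (p k)) → Represents (ℚ⟨x⟩-sum n f) y (sumTo n p)
-- The empty sum of rational functions has numerator `0ℚ ∷ []`, while the empty sum of polynomials
-- is `[]`.
Represents-sum y zero    f p rep = represents (ℚ[X].trans (ℚ[X].*-congʳ {y} constant-zero)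
  (ℚ[X].trans (ℚ[X].zeroˡ y) (ℚ[X].sym (ℚ[X].zeroˡ (1ℚ ∷ [])))))
Represents-sum y (suc n) f p rep = represents
  (fraction-+ {num (f 0)} {den (f 0)} {p 0} {num rest} {den rest} {sumTo n (λ k → p (suc k))} {y}
    (cross-multiplied (rep 0 (s≤s z≤n)))
    (cross-multiplied (Represents-sum y n (λ k → f (suc k)) (λ k → p (suc k)) (λ k k<n → rep (suc k) (s≤s k<n)))))
  where rest = ℚ⟨x⟩-sum n (λ k → f (suc k))

Represents-fromℚ : ∀ c → Represents (fromℚ c) ℚ[X].1# (c ∷ [])
Represents-fromℚ c = represents ℚ[X].refl

Represents-fromℕ : ∀ n → Represents (fromℕ n) ℚ[X].1# ⟦ n ⟧
Represents-fromℕ n = Represents-resp ℚ[X].refl (constant-≡⟦⟧ n (/1 n)) (Represents-fromℚ (+ n ℚ./ 1))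

Represents-∑₀ : ∀ {y} b {f} p → (∀ k → k ≤ b → Represents (f k) y (p k)) → Represents (∑ 0 b f) y (sumTo (suc b) p)
Represents-∑₀ {y} b {f} p rep = Represents-sum y (suc b) f p (λ k k<1+b → rep k (ℕₚ.≤-pred k<1+b))

Represents-∑₁ : ∀ {y} b {f} p → (∀ k → k < b → Represents (f (suc k)) y (p k)) → Represents (∑ 1 b f) y (sumTo b p)
Represents-∑₁ {y} b {f} p = Represents-sum y b (λ k → f (suc k)) p

-- Stated for an arbitrary F because Agda compares rational functions that are not
-- syntactically equal by unfolding them down to their nonvanishing proofs.
Represents-nested : ∀ {y} N k c (A : ℕ → ℕ → ℚ) (F : ℕ → ℕ → ℕ → ℕ → RatFun) (P : ℕ → ℕ → ℕ → ℕ → Poly) →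
  (∀ j l m s → j < N → m ≤ k → Represents (F (suc j) l m s) y (P j l m s)) →
  Represents (fromℚ c ⊗ ∑ 1 N (λ i → ∑ 0 i (λ l → fromℚ (A i l) ⊗ ∑ 0 k (λ m → ∑ 0 (k ∸ m) (λ s → F i l m s)))))
             (ℚ[X].1# *ₚ (ℚ[X].1# *ₚ y))
             ((c ∷ []) *ₚ sumTo N (λ j → sumTo (suc (suc j)) (λ l →
               (A (suc j) l ∷ []) *ₚ sumTo (suc k) (λ m → sumTo (suc (k ∸ m)) (P j l m)))))
Represents-nested {y} N k c A F P rep = Represents-⊗ (Represents-fromℚ c)
  (Represents-∑₁ N {λ i → ∑ 0 i (λ l → fromℚ (A i l) ⊗ ∑ 0 k (λ m → ∑ 0 (k ∸ m) (F i l m)))} _ λ j j<N →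
    Represents-∑₀ (suc j) {λ l → fromℚ (A (suc j) l) ⊗ ∑ 0 k (λ m → ∑ 0 (k ∸ m) (F (suc j) l m))} _ λ l _ →
      Represents-⊗ (Represents-fromℚ (A (suc j) l))
        (Represents-∑₀ k {λ m → ∑ 0 (k ∸ m) (F (suc j) l m)} _ λ m m≤k →
          Represents-∑₀ (k ∸ m) {F (suc j) l m} (P j l m) λ s _ → rep j l m s j<N m≤k))

Represents-X^- : ∀ t → Represents (X^ -[1+ t ]) (X ^ suc t) ℚ[X].1#
Represents-X^- t = powers (suc t)
  where
  open RawSemiringDefs (RawRing.rawSemiring ℚ⟨x⟩-rawRing) using () renaming (_^_ to _^ᶠ_)
  1/X = mkRatFun (1ℚ ∷ []) X NonZeroPoly-X
  powers : ∀ t → Represents (1/X ^ᶠ t) (X ^ t) ℚ[X].1#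
  powers zero    = represents ℚ[X].refl
  powers (suc t) = Represents-resp ℚ[X].refl (ℚ[X].*-identityˡ ℚ[X].1#)
    (Represents-⊗ (represents {1/X} {X} {ℚ[X].1#} ℚ[X].refl) (powers t))

-- Multiplication by `X` shifts the coefficients by one place, hence is injective.
X-cancel : ∀ k {p q} → (X ^ k) *ₚ p ≋ₚ (X ^ k) *ₚ q → p ≋ₚ q
X-cancel zero {p} {q} eq = ℚ[X].trans (ℚ[X].sym (ℚ[X].*-identityˡ p)) (ℚ[X].trans eq (ℚ[X].*-identityˡ q))
X-cancel (suc k) {p} {q} eq = X-cancel k (coefficientwise λ n → ≡.trans (≡.sym (X-shift ((X ^ k) *ₚ p) n)) (≡.trans
    (coefficients (ℚ[X].trans (ℚ[X].sym (ℚ[X].*-assoc X (X ^ k) p)) (ℚ[X].trans eq (ℚ[X].*-assoc X (X ^ k) q))) (suc n))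
    (X-shift ((X ^ k) *ₚ q) n)))
  where
  X-shift : ∀ p n → coeff (X *ₚ p) (suc n) ≡ coeff p n
  X-shift p n = ≡.trans (coeff-* 0ℚ (1ℚ ∷ []) p (suc n))
    (≡.trans (≡.cong₂ ℚ._+_ (ℚₚ.*-zeroˡ (coeff p (suc n))) (coefficients (ℚ[X].*-identityˡ p) n)) (ℚₚ.+-identityˡ (coeff p n)))

Represents-unique : ∀ {f g p} k → Represents f (X ^ k) p → Represents g (X ^ k) p → f ≃ g
Represents-unique {f} {g} {p} k (represents eq₁) (represents eq₂) =
  coefficients (X-cancel k (fraction-unique {num f} {den f} {num g} {den g} {p} {X ^ k} eq₁ eq₂))

-- Both sides of the theorem as fractions with denominator x^(2N+n)

module ℚ[X]⟦t⟧ = FormalPowerSeries ℚ[x]-ring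
module Chebyshev = ChebyshevSeries ℚ[x]-ring X V

V-generating : ℚ[X]⟦t⟧.mul Chebyshev.q V ℚ[X]⟦t⟧.≋ Chebyshev.p
V-generating = ℚ[X]⟦t⟧.quotient-* Chebyshev.p Chebyshev.q ≡.refl

-- Applied with 2N in place of `N`: since i ≤ N < 2N + m, every exponent of x in the theorem is
-- negative and `X^_` is evaluated by its second clause.
negative-exponent : ∀ {i N m t} → suc t ℕ.+ i ≡ N ℕ.+ m → + i ℤ.- + N ℤ.- + m ≡ -[1+ t ]
negative-exponent {i} {N} {m} {t} eq = begin
  + i ℤ.- + N ℤ.- + m           ≡⟨ gather (+ i) (+ N) (+ m) ⟩
  + i ℤ.- (+ N ℤ.+ + m)         ≡⟨ ≡.cong (λ n → + i ℤ.- n) (ℤₚ.pos-+ N m) ⟨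
  + i ℤ.- + (N ℕ.+ m)           ≡⟨ ≡.cong (λ n → + i ℤ.- + n) eq ⟨
  + i ℤ.- + (suc t ℕ.+ i)       ≡⟨ ≡.cong (λ n → + i ℤ.- n) (ℤₚ.pos-+ (suc t) i) ⟩
  + i ℤ.- (+ suc t ℤ.+ + i)     ≡⟨ cancel (+ i) (+ suc t) ⟩
  ℤ.- + suc t                   ∎
  where
  open ≡.≡-Reasoning
  gather : ∀ i n m → i ℤ.- n ℤ.- m ≡ i ℤ.- (n ℤ.+ m)
  gather = ℤ-solve-∀
  cancel : ∀ i t → i ℤ.- (t ℤ.+ i) ≡ ℤ.- t
  cancel = ℤ-solve-∀

module _ (n k : ℕ) where
  open ℚ[X] using (setoid)
  open import Relation.Binary.Reasoning.Setoid setoid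

  y : Poly
  y = (X ^ (2 ℕ.* suc n)) *ₚ (X ^ k)

  summand : (j l m s : ℕ) → Poly
  summand = Chebyshev.summand V-generating n k

  Represents-term : ∀ j l m s → j ≤ n → m ≤ k → let i = suc j; p = k ∸ m ∸ s in
    Represents (fromℕ ((2 ℕ.* suc n ℕ.+ m ∸ i ∸ 1) C m)
                ⊗ fromℕ ((i ∸ l ℕ.+ s) C s)
                ⊗ fromℚ (fallingFactorial (+ (p ℕ.+ l) ℚ./ 1) l)
                ⊗ X^ (+ i ℤ.- + (2 ℕ.* suc n) ℤ.- + m)
                ⊗ fromPoly (V (p ℕ.+ l)))
               y (summand j l m s)
  Represents-term j l m s j≤n m≤k =
    Represents-resp denominator numerator
      (Represents-expand z
        (Represents-⊗ (Represents-⊗ (Represents-⊗ (Represents-⊗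
          (Represents-fromℕ ((2 ℕ.* suc n ℕ.+ m ∸ suc j ∸ 1) C m)) (Represents-fromℕ ((suc j ∸ l ℕ.+ s) C s)))
          (Represents-fromℚ (fallingFactorial (+ (r ℕ.+ l) ℚ./ 1) l)))
          (≡.subst (λ e → Represents (X^ e) (X ^ suc t) ℚ[X].1#) (≡.sym (negative-exponent {suc j} {2 ℕ.* suc n} {m} exponent)) (Represents-X^- t)))
          (Represents-fromPoly v)))
    where
    -- t = 2N + m - i - 1 is the upper index of the first binomial coefficient and also one less
    -- than the exponent of x in the denominator of the term.
    t = 2 ℕ.* n ∸ j ℕ.+ m
    r = k ∸ m ∸ s
    v = V (r ℕ.+ l)
    -- The factor that completes the denominator `X ^ suc t` of the term to the common denominator
    -- `y`.
    z = X ^ (suc j ℕ.+ (k ∸ m))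
    α = ⟦ (2 ℕ.* suc n ℕ.+ m ∸ suc j ∸ 1) C m ⟧
    β = ⟦ (suc j ∸ l ℕ.+ s) C s ⟧
    φ = fallingFactorial (+ (r ℕ.+ l) ℚ./ 1) l ∷ []
    2n-j+j : 2 ℕ.* n ∸ j ℕ.+ j ≡ 2 ℕ.* n
    2n-j+j = ℕₚ.m∸n+n≡m (ℕₚ.≤-trans j≤n (ℕₚ.m≤m+n n _))
    exponent : suc t ℕ.+ suc j ≡ 2 ℕ.* suc n ℕ.+ m
    exponent = ≡.trans (regroup (2 ℕ.* n ∸ j) j m) (≡.trans (≡.cong (λ e → 2 ℕ.+ e ℕ.+ m) 2n-j+j) (≡.cong (ℕ._+ m) (≡.sym (ℕₚ.*-suc 2 n))))
      where
      regroup : ∀ e j m → suc (e ℕ.+ m) ℕ.+ suc j ≡ 2 ℕ.+ (e ℕ.+ j) ℕ.+ m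
      regroup = ℕ-solve-∀
    upper : 2 ℕ.* suc n ℕ.+ m ∸ suc j ∸ 1 ≡ t
    upper = ≡.cong (_∸ 1) (≡.trans (≡.cong (_∸ suc j) (≡.sym exponent)) (ℕₚ.m+n∸n≡m (suc t) (suc j)))
    total : suc t ℕ.+ (suc j ℕ.+ (k ∸ m)) ≡ 2 ℕ.* suc n ℕ.+ k
    total = ≡.trans (≡.sym (ℕₚ.+-assoc (suc t) (suc j) (k ∸ m))) (≡.trans (≡.cong (ℕ._+ (k ∸ m)) exponent)
      (≡.trans (ℕₚ.+-assoc (2 ℕ.* suc n) m (k ∸ m)) (≡.cong (2 ℕ.* suc n ℕ.+_) (ℕₚ.m+[n∸m]≡n m≤k))))
    denominator : ℚ[X].1# *ₚ ℚ[X].1# *ₚ ℚ[X].1# *ₚ (X ^ suc t) *ₚ ℚ[X].1# *ₚ z ≋ₚ y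
    denominator = begin
      ℚ[X].1# *ₚ ℚ[X].1# *ₚ ℚ[X].1# *ₚ (X ^ suc t) *ₚ ℚ[X].1# *ₚ z
        ≈⟨ ℚ[X]Ranges.solve 2 (λ x z → con 1 :* con 1 :* con 1 :* x :* con 1 :* z := x :* z)
             ℚ[X].refl (X ^ suc t) z ⟩
      (X ^ suc t) *ₚ z                        ≈⟨ coefficientwise (^-homo-* X (suc t) (suc j ℕ.+ (k ∸ m))) ⟨
      X ^ (suc t ℕ.+ (suc j ℕ.+ (k ∸ m)))     ≡⟨ ≡.cong (X ^_) total ⟩
      X ^ (2 ℕ.* suc n ℕ.+ k)                 ≈⟨ coefficientwise (^-homo-* X (2 ℕ.* suc n) k) ⟩
      y                                       ∎
    numerator : α *ₚ β *ₚ φ *ₚ ℚ[X].1# *ₚ v *ₚ z ≋ₚ summand j l m s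
    numerator = begin
      α *ₚ β *ₚ φ *ₚ ℚ[X].1# *ₚ v *ₚ z
        ≈⟨ ℚ[X]Ranges.solve 3 (λ a v z → a :* con 1 :* v :* z := a :* (z :* v)) ℚ[X].refl (α *ₚ β *ₚ φ) v z ⟩
      α *ₚ β *ₚ φ *ₚ (z *ₚ v)
        ≈⟨ ℚ[X].*-congʳ (ℚ[X].*-cong (ℚ[X].*-congʳ {β} (ℚ[X].reflexive (≡.cong (λ i → ⟦ i C m ⟧) upper)))
             (constant-≡⟦⟧ (risingFactorial r l) (fallingFactorial-rising r l))) ⟩
      summand j l m s ∎

  coefficient : ∀ j l → j ≤ n → l ≤ suc j →
    (a (suc j) (suc n) ℚ.* (suc j !/ l !) ∷ []) ≋ₚ ⟦ aℕ n j ⟧ *ₚ ⟦ quotient-! l (suc j ∸ l) ⟧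
  coefficient j l j≤n l≤i = ℚ[X].trans (constant-* (a (suc j) (suc n)) (suc j !/ l !))
    (ℚ[X].*-cong (constant-≡⟦⟧ (aℕ n j) (≡.subst (λ n → a (suc j) (suc n) ≡ ℚ⟦ aℕ n j ⟧) (ℕₚ.m+[n∸m]≡n j≤n) (a-aℕ j (n ∸ j))))
                 (constant-≡⟦⟧ (quotient-! l (suc j ∸ l)) (!/!-quotient l≤i)))

  summand-sum : ℕ → ℕ → Poly
  summand-sum j l = sumTo (suc k) (λ m → sumTo (suc (k ∸ m)) (summand j l m))

  lhs-poly : Poly
  lhs-poly = sumTo (suc k) (λ l → V⟨ suc (suc n) ⟩ l *ₚ ⟦ (suc n ℕ.+ (k ∸ l)) C (k ∸ l) ⟧)

  -- By `coefficient` the rational weights are integers, so the double sum is the right side of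
  -- `coefficient-identity`; its factor 2^N N! then cancels the constant in front.
  scaled-sum : (1/2^ suc n * suc n ! ∷ []) *ₚ sumTo (suc n) (λ j → sumTo (suc (suc j)) (λ l →
                 (a (suc j) (suc n) ℚ.* (suc j !/ l !) ∷ []) *ₚ summand-sum j l)) ≋ₚ
               (X ^ (2 ℕ.* suc n)) *ₚ ((X ^ k) *ₚ lhs-poly)
  scaled-sum = begin
    (1/c ∷ []) *ₚ sumTo (suc n) row
      ≈⟨ ℚ[X].*-congˡ {1/c ∷ []} (ℚ[X]Ranges.sumTo-cong (suc n) {row} {factored} factor) ⟩
    (1/c ∷ []) *ₚ sumTo (suc n) factored
      ≈⟨ ℚ[X].*-congˡ {1/c ∷ []} (coefficientwise (Chebyshev.coefficient-identity V-generating n k)) ⟨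
    (1/c ∷ []) *ₚ (⟦ c ⟧ *ₚ Y)
      ≈⟨ ℚ[X].*-assoc (1/c ∷ []) ⟦ c ⟧ Y ⟨
    (1/c ∷ []) *ₚ ⟦ c ⟧ *ₚ Y
      ≈⟨ ℚ[X].*-congʳ (ℚ[X].*-congˡ {1/c ∷ []} (constant-⟦⟧ c)) ⟨
    (1/c ∷ []) *ₚ (ℚ⟦ c ⟧ ∷ []) *ₚ Y
      ≈⟨ ℚ[X].*-congʳ (constant-* 1/c ℚ⟦ c ⟧) ⟨
    (1/c ℚ.* ℚ⟦ c ⟧ ∷ []) *ₚ Y
      ≡⟨ ≡.cong (λ u → (u ∷ []) *ₚ Y) (1/-*-⟦⟧ (suc n) (suc n)) ⟩
    ℚ[X].1# *ₚ Y
      ≈⟨ ℚ[X].*-identityˡ Y ⟩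
    Y ∎
    where
    1/c = 1/2^ suc n * suc n !
    c = 2 ℕ.^ suc n ℕ.* suc n !
    Y = (X ^ (2 ℕ.* suc n)) *ₚ ((X ^ k) *ₚ lhs-poly)
    weighted : ℕ → ℕ → Poly
    weighted j l = ⟦ quotient-! l (suc j ∸ l) ⟧ *ₚ summand-sum j l
    row factored : ℕ → Poly
    row j = sumTo (suc (suc j)) (λ l → (a (suc j) (suc n) ℚ.* (suc j !/ l !) ∷ []) *ₚ summand-sum j l)
    factored j = ⟦ aℕ n j ⟧ *ₚ sumTo (suc (suc j)) (weighted j)
    factor : ∀ j → j < suc n → row j ≋ₚ factored j
    factor j (s≤s j≤n) = ℚ[X].trans
      (ℚ[X]Ranges.sumTo-cong (suc (suc j)) {λ l → (a (suc j) (suc n) ℚ.* (suc j !/ l !) ∷ []) *ₚ summand-sum j l} {λ l → ⟦ aℕ n j ⟧ *ₚ weighted j l}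
        λ l l<2+j → ℚ[X].trans (ℚ[X].*-congʳ (coefficient j l j≤n (ℕₚ.≤-pred l<2+j)))
                               (ℚ[X].*-assoc ⟦ aℕ n j ⟧ ⟦ quotient-! l (suc j ∸ l) ⟧ (summand-sum j l)))
      (ℚ[X].sym (ℚ[X]Ranges.sumTo-* (suc (suc j)) ⟦ aℕ n j ⟧ (weighted j)))

  -- The terms are polynomials, of denominator 1. Expanding by `y` gives the numerator that
  -- `scaled-sum` obtains for the other side.
  Represents-lhs : Represents
    (∑ 0 k (λ l → fromℕ ((suc n ℕ.+ k ∸ l) C (k ∸ l)) ⊗ fromPoly (V⟨ suc n ℕ.+ 1 ⟩ l)))
    y ((X ^ (2 ℕ.* suc n)) *ₚ ((X ^ k) *ₚ lhs-poly))
  Represents-lhs = Represents-resp (ℚ[X].*-identityˡ y)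
    (ℚ[X]Ranges.solve 3 (λ p x z → p :* (x :* z) := x :* (z :* p))
         ℚ[X].refl lhs-poly (X ^ (2 ℕ.* suc n)) (X ^ k))
    (Represents-expand y (Represents-∑₀ k (λ l → V⟨ suc (suc n) ⟩ l *ₚ ⟦ (suc n ℕ.+ (k ∸ l)) C (k ∸ l) ⟧) λ l l≤k →
      Represents-resp (ℚ[X].*-identityˡ ℚ[X].1#) (term l l≤k)
        (Represents-⊗ (Represents-fromℕ ((suc n ℕ.+ k ∸ l) C (k ∸ l))) (Represents-fromPoly (V⟨ suc n ℕ.+ 1 ⟩ l)))))
    where
    term : ∀ l → l ≤ k → ⟦ (suc n ℕ.+ k ∸ l) C (k ∸ l) ⟧ *ₚ V⟨ suc n ℕ.+ 1 ⟩ l ≋ₚ V⟨ suc (suc n) ⟩ l *ₚ ⟦ (suc n ℕ.+ (k ∸ l)) C (k ∸ l) ⟧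
    term l l≤k = begin
      ⟦ (suc n ℕ.+ k ∸ l) C (k ∸ l) ⟧ *ₚ V⟨ suc n ℕ.+ 1 ⟩ l
        ≈⟨ ℚ[X].*-comm ⟦ (suc n ℕ.+ k ∸ l) C (k ∸ l) ⟧ (V⟨ suc n ℕ.+ 1 ⟩ l) ⟩
      V⟨ suc n ℕ.+ 1 ⟩ l *ₚ ⟦ (suc n ℕ.+ k ∸ l) C (k ∸ l) ⟧
        ≡⟨ ≡.cong₂ (λ α m → V⟨ α ⟩ l *ₚ ⟦ m C (k ∸ l) ⟧) (ℕₚ.+-comm (suc n) 1) (ℕₚ.+-∸-assoc (suc n) l≤k) ⟩
      V⟨ suc (suc n) ⟩ l *ₚ ⟦ (suc n ℕ.+ (k ∸ l)) C (k ∸ l) ⟧     ∎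

  X^-split : y ≋ₚ X ^ (2 ℕ.* suc n ℕ.+ k)
  X^-split = ℚ[X].sym (coefficientwise (^-homo-* X (2 ℕ.* suc n) k))

open import Data.Nat.Base using (_+_; _*_)

theorem5 : ∀ (N n : ℕ) → 1 ≤ N →
    ∑ 0 n (λ l → fromℕ ((N + n ∸ l) C (n ∸ l)) ⊗ fromPoly (V⟨ N + 1 ⟩ l))
    ≃
    fromℚ (1/2^ N * N !)
    ⊗ ∑ 1 N (λ i → ∑ 0 i (λ l →
    fromℚ (a i N ℚ.* (i !/ l !))
    ⊗ ∑ 0 n (λ m → ∑ 0 (n ∸ m) (λ s → let p = n ∸ m ∸ s in
    fromℕ ((2 * N + m ∸ i ∸ 1) C m)
    ⊗ fromℕ ((i ∸ l + s) C s)
    ⊗ fromℚ (fallingFactorial (+ (p + l) ℚ./ 1) l)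
    ⊗ X^ (+ i ℤ.- + (2 * N) ℤ.- + m)
    ⊗ fromPoly (V (p + l))))))
theorem5 (suc N) n _ = Represents-unique (2 * suc N + n)
  (Represents-resp (X^-split N n) ℚ[X].refl (Represents-lhs N n))
  -- The outer constant and the weights have denominator 1, so the nested sum comes with denominator
  -- 1 (1 y), which is rewritten as a single power of `X`.
  (Represents-resp (ℚ[X].trans (ℚ[X].*-identityˡ _) (ℚ[X].trans (ℚ[X].*-identityˡ (y N n)) (X^-split N n))) (scaled-sum N n)
    (Represents-nested (suc N) n (1/2^ suc N * suc N !) (λ i l → a i (suc N) ℚ.* (i !/ l !))
      (λ i l m s → let p = n ∸ m ∸ s in
        fromℕ ((2 * suc N + m ∸ i ∸ 1) C m)
        ⊗ fromℕ ((i ∸ l + s) C s)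
        ⊗ fromℚ (fallingFactorial (+ (p + l) ℚ./ 1) l)
        ⊗ X^ (+ i ℤ.- + (2 * suc N) ℤ.- + m)
        ⊗ fromPoly (V (p + l)))
      (summand N n)
      (λ j l m s j<1+N → Represents-term N n j l m s (ℕₚ.≤-pred j<1+N))))
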